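{- Let $\alpha\in(0,1]$ be rational and let $M^{*}=M^{*}_{\alpha}$ be the $(\mathcal{C}^{>0}_{\alpha},\leq^{*}_{\alpha})$-generic structure. Then $M^{*}$ (equivalently, $\mathrm{Th}(M^{*})$) does not have the finite model property.
   Context: $\mathcal{L}=\{R\}$ with $R$ a ternary relation symbol; in all structures $R$ is symmetric and holds only of triples of distinct elements. $\mathcal{C}$ is the class of all finite such structures (including $\emptyset$). For $\alpha\in(0,1]$ and $A\in\mathcal{C}$, $\delta_{\alpha}(A)=|A|-\alpha|R^{A}|$, where $|R^{A}|$ is the number of relations in $A$ (counted as unordered triples). For finite $A\subseteq B$: $A\leq^{*}_{\alpha}B$ means $\delta_{\alpha}(A)<\delta_{\alpha}(C)$ for every $C$ with $A\subsetneq C\subseteq B$. $\mathcal{C}^{>0}_{\alpha}=\{A\in\mathcal{C}:\emptyset\leq^{*}_{\alpha}A\}$, and $\bar{\mathcal{C}}^{>0}_{\alpha}$ is the class of all $\mathcal{L}$-structures all of whose finite substructures lie in $\mathcal{C}^{>0}_{\alpha}$. For $M\in\bar{\mathcal{C}}^{>0}_{\alpha}$ and finite $A\subseteq M$, $A\leq^{*}_{\alpha}M$ means $A\leq^{*}_{\alpha}B$ for all finite $B$ with $A\subseteq B\subseteq M$. $M^{*}_{\alpha}$ is the (unique up to isomorphism) countable $\mathcal{L}$-structure $M$ with: (1) $M\in\bar{\mathcal{C}}^{>0}_{\alpha}$; (2) whenever $A\leq^{*}_{\alpha}M$ is finite and $A\leq^{*}_{\alpha}B\in\mathcal{C}^{>0}_{\alpha}$,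 there is $B'\subseteq M$ with $B'\cong_{A}B$ and $B'\leq^{*}_{\alpha}M$; (3) $M$ is the union of a chain $\{A_{i}:i\in\omega\}$ with $A_{i}\in\mathcal{C}^{>0}_{\alpha}$ and $A_{i}\leq^{*}_{\alpha}A_{i+1}$. A structure (or its complete theory) has the finite model property if every first-order sentence true in it has a finite model. -}

module Defs where

open import Data.Bool using (Bool; T)
open import Data.Bool.Properties using (T?)
open import Data.Empty using (⊥; ⊥-elim)
open import Data.Fin using (Fin; zero; suc)
open import Data.Integer using (+_)
open import Data.List using (List; []; _∷_; _++_; map; length; filter; allFin) renaming (lookup to _‼_)
open import Data.List.Membership.Propositional using (_∈_)
open import Data.List.Membership.Propositional.Properties using (∈-lookup)
import Data.List.Relation.Binary.Subset.Propositional as List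
open import Data.List.Relation.Unary.All as All using ()
open import Data.List.Relation.Unary.AllPairs using ([]; _∷_)
open import Data.List.Relation.Unary.Unique.Propositional using (Unique)
open import Data.List.Relation.Unary.Unique.Propositional.Properties using (map⁺; allFin⁺)
open import Data.Nat using (ℕ; zero; suc)
open import Data.Product using (_×_; _,_; ∃-syntax; Σ-syntax)
open import Data.Rational using (ℚ; _/_; _-_; _*_; _<_)
open import Data.Vec using (Vec; []; _∷_; lookup)
open import Function using (_∘_; Injective)
open import Relation.Binary.PropositionalEquality using (_≡_; _≢_; refl; sym; cong)
open import Relation.Nullary using (¬_)

-- Structures with universe X.  The relation is given by its characteristic
-- function.  The two symmetry laws generate all permutations of the arguments.
record Str (X : Set) : Set where
  field
    R          : X → X → X → Bool
    R-swap₁₂   : ∀ x y z → R x y z ≡ R y x z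
    R-swap₂₃   : ∀ x y z → R x y z ≡ R x z y
    R-distinct : ∀ {x y z} → T (R x y z) → x ≢ y × y ≢ z × x ≢ z

open Str public

record FinSubset (X : Set) : Set where
  constructor ⟨_,_⟩
  field
    elems  : List X
    unique : Unique elems

open FinSubset public

∅ : ∀ {X} → FinSubset X
∅ = ⟨ [] , [] ⟩

universe : ∀ n → FinSubset (Fin n)
universe n = ⟨ allFin n , allFin⁺ n ⟩

_⊆_ : ∀ {X} → FinSubset X → FinSubset X → Set
A ⊆ B = elems A List.⊆ elems B

_⊊_ : ∀ {X} → FinSubset X → FinSubset X → Set
A ⊊ B = A ⊆ B × ¬ (B ⊆ A)

∣_∣ : ∀ {X} → FinSubset X → ℕ
∣ A ∣ = length (elems A)

pairs : ∀ {X : Set} → List X → List (X × X)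
pairs []       = []
pairs (x ∷ xs) = map (x ,_) xs ++ pairs xs

-- On a list without repetitions, every three-element subset is listed once.
triples : ∀ {X : Set} → List X → List (X × X × X)
triples []       = []
triples (x ∷ xs) = map (x ,_) (pairs xs) ++ triples xs

∣R∣ : ∀ {X} → Str X → FinSubset X → ℕ
∣R∣ S A = length (filter (λ (x , y , z) → T? (R S x y z)) (triples (elems A)))

fromℕ : ℕ → ℚ
fromℕ n = + n / 1

-- A finite subset A of S stands for the substructure of S with universe A.
δ : ∀ {X} → ℚ → Str X → FinSubset X → ℚ
δ α S A = fromℕ ∣ A ∣ - α * fromℕ (∣R∣ S A)

-- A ≤* B, for the substructures of S with universes A and B.
Strong : ∀ {X} → ℚ → Str X → FinSubset X → FinSubset X → Set
Strong α S A B = A ⊆ B × (∀ C → A ⊊ C → C ⊆ B → δ α S A < δ α S C)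

-- A ≤* S, for S possibly infinite.
StrongIn : ∀ {X} → ℚ → Str X → FinSubset X → Set
StrongIn α S A = ∀ B → A ⊆ B → Strong α S A B

-- The substructure of S with universe A belongs to 𝒞^{>0}.
InClass : ∀ {X} → ℚ → Str X → FinSubset X → Set
InClass α S A = Strong α S ∅ A

lookup-injective : ∀ {X : Set} {xs : List X} → Unique xs → Injective _≡_ _≡_ (xs ‼_)
lookup-injective (x∉ ∷ u) {zero}  {zero}  eq = refl
lookup-injective (x∉ ∷ u) {zero}  {suc j} eq = ⊥-elim (All.lookup x∉ (∈-lookup j) eq)
lookup-injective (x∉ ∷ u) {suc i} {zero}  eq = ⊥-elim (All.lookup x∉ (∈-lookup i) (sym eq))
lookup-injective (x∉ ∷ u) {suc i} {suc j} eq = cong suc (lookup-injective u eq)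

-- The induced substructure, as a structure in its own right: the point i of
-- S ↾ A is the i-th element of A.
_↾_ : ∀ {X} → Str X → (A : FinSubset X) → Str (Fin ∣ A ∣)
(S ↾ A) .R i j k = R S (elems A ‼ i) (elems A ‼ j) (elems A ‼ k)
(S ↾ A) .R-swap₁₂ _ _ _ = R-swap₁₂ S _ _ _
(S ↾ A) .R-swap₂₃ _ _ _ = R-swap₂₃ S _ _ _
(S ↾ A) .R-distinct r with R-distinct S r
... | x≢y , y≢z , x≢z =
  x≢y ∘ cong (elems A ‼_) , y≢z ∘ cong (elems A ‼_) , x≢z ∘ cong (elems A ‼_)

record _↪_ {X Y : Set} (S : Str X) (S′ : Str Y) : Set where
  field
    to        : X → Y
    injective : Injective _≡_ _≡_ to
    R-iff     : ∀ x y z → R S′ (to x) (to y) (to z) ≡ R S x y z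

open _↪_ public

image : ∀ {n Y} {S : Str (Fin n)} {S′ : Str Y} → S ↪ S′ → FinSubset Y
image {n} f = ⟨ map (to f) (allFin n) , map⁺ (injective f) (allFin⁺ n) ⟩

-- M is (𝒞^{>0}, ≤*)-generic.  Finite structures are taken, up to isomorphism,
-- on the sets Fin n.
record IsGeneric {X : Set} (α : ℚ) (M : Str X) : Set where
  field
    inClass : ∀ A → InClass α M A

    -- B extends A through the embedding f; the image of g is the copy B′ of B
    -- over A.
    extension : ∀ A → StrongIn α M A →
                ∀ {n} (B : Str (Fin n)) → InClass α B (universe n) →
                (f : (M ↾ A) ↪ B) → Strong α B (image f) (universe n) →
                Σ[ g ∈ B ↪ M ] (∀ i → to g (to f i) ≡ elems A ‼ i) × StrongIn α M (image g)

    chain : Σ[ A ∈ (ℕ → FinSubset X) ]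
              (∀ i → InClass α M (A i)) ×
              (∀ i → Strong α M (A i) (A (suc i))) ×
              (∀ x → ∃[ i ] x ∈ elems (A i))

-- First-order formulas with n free variables (de Bruijn indices).  The
-- connectives ⊥, ⇒ and ∀ define all the others classically.  Leaving out
-- primitive ∨ and ∃ makes satisfaction ¬¬-stable whenever equality on the
-- universe is decidable, so that it obeys classical logic.
infixr 5 _⇒_
data Formula (n : ℕ) : Set where
  _≐_ : (i j : Fin n) → Formula n
  rel : (i j k : Fin n) → Formula n
  ⊥′  : Formula n
  _⇒_ : (φ ψ : Formula n) → Formula n
  ∀′  : (φ : Formula (suc n)) → Formula n

Sentence : Set
Sentence = Formula 0

Sat : ∀ {X n} → Str X → Vec X n → Formula n → Set
Sat S ρ (i ≐ j)     = lookup ρ i ≡ lookup ρ j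
Sat S ρ (rel i j k) = T (R S (lookup ρ i) (lookup ρ j) (lookup ρ k))
Sat S ρ ⊥′          = ⊥
Sat S ρ (φ ⇒ ψ)     = Sat S ρ φ → Sat S ρ ψ
Sat S ρ (∀′ φ)      = ∀ x → Sat S (x ∷ ρ) φ

_⊨_ : ∀ {X} → Str X → Sentence → Set
S ⊨ φ = Sat S [] φ

FiniteModelProperty : ∀ {X} → Str X → Set
FiniteModelProperty S = ∀ φ → S ⊨ φ → ∃[ n ] Σ[ N ∈ Str (Fin n) ] N ⊨ φ

{-# OPTIONS --safe #-}
module Submission where

-- Write α = a / b.  A gadget over P = (u , q₀ , … , q_{b−1}) consists of a new
-- points E carrying b edges, each with a different q; it is built so that adding
-- it never changes δ, while adding only a part of it never lowers δ.  Hence a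
-- strong finite subset of M contains all gadgets over its points, and the set
-- Z P = { E 0 ∣ E is a gadget over P } is finite.  On the other hand, any finite
-- strong A can be strongly extended by new points P′, by as many gadgets over P′
-- as desired, and by gadgets over (y , x , q′₁ , …) for prescribed pairs (x , y)
-- with x in A and y in Z P′; the new points P′ make the extension strong.  So M
-- satisfies the sentence "for all P there is P′ such that the pairs (x , y) over
-- which a gadget exists define an injection from Z P to a proper subset of Z P′".
-- In a finite model, P with Z P of maximal size would be a contradiction.

open import Defs
open import Algebra.Properties.CommutativeSemigroup using (xy∙z≈xz∙y)
open import Data.Bool using (Bool; true; false; T)
open import Data.Bool.Properties using (T?)
open import Data.Empty using (⊥; ⊥-elim)
open import Data.Fin as Fin using (Fin; zero; suc; toℕ; inject₁; _↑ˡ_; _↑ʳ_)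
import Data.Fin.Properties as Fin
import Data.Integer as ℤ
import Data.Integer.Properties as ℤ
import Data.Integer.Tactic.RingSolver as ℤ
open import Data.List using (List; []; _∷_; _++_; map; length; filter; foldr; cartesianProduct; allFin)
  renaming (lookup to _‼_)
import Data.List.Membership.DecPropositional as DecMembership
open import Data.List.Membership.Propositional using (_∈_; _∉_; find; lose)
open import Data.List.Membership.Propositional.Properties
  using (∈-map⁺; ∈-map⁻; ∈-++⁺ˡ; ∈-++⁺ʳ; ∈-++⁻; ∈-filter⁺; ∈-filter⁻; ∈-allFin;
         ∈-cartesianProduct⁺; ∈-cartesianProduct⁻)
open import Data.List.Properties using (length-++; length-map; length-tabulate; length-removeAt′; map-++; map-∘)
open import Data.List.Relation.Unary.All as All using (All; []; _∷_; all?)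
import Data.List.Relation.Unary.All.Properties as All
open import Data.List.Relation.Unary.AllPairs as AllPairs using (AllPairs; []; _∷_)
import Data.List.Relation.Unary.AllPairs.Properties as AllPairs
open import Data.List.Relation.Unary.Any as Any using (Any; here; there; any?; index; _─_)
import Data.List.Relation.Unary.Any.Properties as Any
open import Data.List.Relation.Unary.Unique.Propositional using (Unique)
import Data.List.Relation.Unary.Unique.Propositional.Properties as Unique
open import Data.Nat as ℕ using (ℕ; zero; suc; _+_; _*_; _⊔_; z≤n; s≤s)
open import Data.Nat.ListAction using (sum)
import Data.Nat.Properties as ℕ
import Data.Nat.Tactic.RingSolver as ℕ
open import Data.Product using (_×_; _,_; ∃-syntax; Σ-syntax; proj₁; proj₂; map₂; uncurry)
open import Data.Product.Function.NonDependent.Propositional using (_×-↔_)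
open import Data.Product.Properties using (,-injectiveˡ)
open import Data.Rational as ℚ using (ℚ; mkℚ; 0ℚ; 1ℚ; _<_; _≤_)
import Data.Rational.Properties as ℚ
open import Data.Rational.Unnormalised as ℚᵘ using (mkℚᵘ) renaming (_≃_ to _≃ᵘ_)
import Data.Rational.Unnormalised.Properties as ℚᵘ
open import Data.Sum using (_⊎_; inj₁; inj₂; [_,_]′)
open import Data.Sum.Function.Propositional using (_⊎-↔_)
open import Data.Sum.Properties using (inj₁-injective; inj₂-injective; ≡-dec)
open import Data.Unit using (⊤; tt)
open import Data.Vec using (Vec; []; _∷_; lookup; tabulate) renaming (_++_ to _⧺_)
open import Data.Vec.Properties using (lookup-++ˡ; lookup-++ʳ; lookup∘tabulate; tabulate∘lookup)
open import Function using (_∘_; Injective; mk⇔; _⇔_)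
open import Function.Bundles using (_↔_; _↣_; mk↔ₛ′; Inverse; Equivalence)
open import Function.Construct.Composition using (_↔-∘_)
open import Function.Construct.Identity using (↔-id)
open import Function.Construct.Symmetry using (↔-sym)
open import Function.Properties.Inverse using (↔⇒↣)
open import Relation.Binary using (DecidableEquality)
open import Relation.Binary.PropositionalEquality
  using (_≡_; _≢_; _≗_; refl; sym; trans; cong; cong₂; subst; subst₂; module ≡-Reasoning)
open import Relation.Nullary using (¬_; Dec; _because_; ofʸ; yes; no; does; ¬?; map′; toSum; _×-dec_; _⊎-dec_)
open import Relation.Nullary.Decidable using (does-⇔; dec-true)
open import Relation.Unary using (Decidable)

-- Rationality of α gives an extension of weight exactly zero: `a` points and `b` edges contribute a
-- - αb = 0. As ≤* demands a strict increase, a strong set cannot leave such an extension outside.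
-- The weight estimates are injections of unit cells, `b` per point and `a` per edge: closure of
-- strong sets sends cells of points to cells of edges, strength of the extension sends cells of
-- edges to cells of points.
--
-- The size of Z P has no bound uniform in P, so its finiteness cannot be put into the sentence.
-- Growth can, provided the injection is definable from `R`; coding each pair by a gadget does this
-- at no cost in weight. The danger is unintended pairs. The copy of the extension in M is strong,
-- so gadgets over its points stay inside it, where all edges are known. Only the first edge of a
-- gadget is then inspected: it contains both points of a coded pair, and a new edge contains an old
-- point only if it is such an edge.

module _ {A B : Set} (_~_ : A → B → Set) where

  Any-─ : ∀ {x x′ ys} (p : Any (x ~_) ys) → (∀ y → x ~ y → ¬ x′ ~ y) →
          Any (x′ ~_) ys → Any (x′ ~_) (ys ─ p)
  Any-─ (here x~y) # (here x′~y) = ⊥-elim (# _ x~y x′~y)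
  Any-─ (here _)   # (there q)   = q
  Any-─ (there p)  # (here x′~y) = here x′~y
  Any-─ (there p)  # (there q)   = there (Any-─ p # q)

  -- A relation takes the place of a function because edges are matched only up to `≈`. Each `x`
  -- removes its match from `ys`; no later `x′` is related to that entry, so `Any-─` keeps the later
  -- matches.
  pigeonhole : ∀ {xs ys} → AllPairs (λ x x′ → ∀ y → x ~ y → ¬ x′ ~ y) xs →
               (∀ {x} → x ∈ xs → Any (x ~_) ys) → length xs ℕ.≤ length ys
  pigeonhole {[]}     _        _  = z≤n
  pigeonhole {x ∷ xs} {ys} (# ∷ #s) ~∈ =
    ℕ.≤-trans (s≤s (pigeonhole #s λ x′∈ → Any-─ p (All.lookup # x′∈) (~∈ (there x′∈))))
              (ℕ.≤-reflexive (sym (length-removeAt′ ys (index p))))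
    where p = ~∈ (here refl)

length-≤ : ∀ {A B : Set} {xs : List A} {ys : List B} (f : A → B) → Injective _≡_ _≡_ f →
           Unique xs → (∀ {x} → x ∈ xs → f x ∈ ys) → length xs ℕ.≤ length ys
length-≤ f f-inj u f∈ = pigeonhole (λ x y → f x ≡ y)
  (AllPairs.map (λ x≢x′ y fx≡y fx′≡y → x≢x′ (f-inj (trans fx≡y (sym fx′≡y)))) u) f∈

-- Edges up to the order of their endpoints

Triple : Set → Set
Triple X = X × X × X

toList : ∀ {X : Set} → Triple X → List X
toList (x , y , z) = x ∷ y ∷ z ∷ []

infix 4 _⊑_ _≈_

_⊑_ : ∀ {X : Set} → Triple X → Triple X → Set
t ⊑ u = All (_∈ toList u) (toList t)

_≈_ : ∀ {X : Set} → Triple X → Triple X → Set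
t ≈ u = t ⊑ u × u ⊑ t

pattern 0th p = here p
pattern 1st p = there (here p)
pattern 2nd p = there (there (here p))

module _ {X : Set} where

  ≈-sym : {t u : Triple X} → t ≈ u → u ≈ t
  ≈-sym (p , q) = q , p

  ⊑-trans : {t u v : Triple X} → t ⊑ u → u ⊑ v → t ⊑ v
  ⊑-trans p q = All.map (λ x∈ → All.lookup q x∈) p

  ≈-trans : {t u v : Triple X} → t ≈ u → u ≈ v → t ≈ v
  ≈-trans (p , p′) (q , q′) = ⊑-trans p q , ⊑-trans q′ p′

  ≈-refl : {t : Triple X} → t ≈ t
  ≈-refl = All.tabulate (λ p → p) , All.tabulate (λ p → p)

  ≈-swap₁₂ : ∀ {x y z : X} → (x , y , z) ≈ (y , x , z)
  ≈-swap₁₂ = (1st refl ∷ 0th refl ∷ 2nd refl ∷ []) , (1st refl ∷ 0th refl ∷ 2nd refl ∷ [])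

  ≈-swap₂₃ : ∀ {x y z : X} → (x , y , z) ≈ (x , z , y)
  ≈-swap₂₃ = (0th refl ∷ 2nd refl ∷ 1st refl ∷ []) , (0th refl ∷ 2nd refl ∷ 1st refl ∷ [])

  pairs⁻ : ∀ {y z} (xs : List X) → (y , z) ∈ pairs xs → y ∈ xs × z ∈ xs
  pairs⁻ (x ∷ xs) p with ∈-++⁻ (map (x ,_) xs) p
  ... | inj₂ q = there (proj₁ (pairs⁻ xs q)) , there (proj₂ (pairs⁻ xs q))
  ... | inj₁ q with ∈-map⁻ (x ,_) q
  ...   | _ , z∈ , refl = here refl , there z∈

  triples⁻ : ∀ {t} (xs : List X) → t ∈ triples xs → All (_∈ xs) (toList t)
  triples⁻ (x ∷ xs) p with ∈-++⁻ (map (x ,_) (pairs xs)) p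
  ... | inj₂ q = All.map there (triples⁻ xs q)
  ... | inj₁ q with ∈-map⁻ (x ,_) q
  ...   | _ , yz∈ , refl with pairs⁻ xs yz∈
  ...     | y∈ , z∈ = here refl ∷ there y∈ ∷ there z∈ ∷ []

  pairs⁺ : ∀ {y z} {xs : List X} → y ≢ z → y ∈ xs → z ∈ xs → (y , z) ∈ pairs xs ⊎ (z , y) ∈ pairs xs
  pairs⁺ y≢z (here refl) (here refl) = ⊥-elim (y≢z refl)
  pairs⁺ y≢z (here refl) (there z∈)  = inj₁ (∈-++⁺ˡ (∈-map⁺ _ z∈))
  pairs⁺ y≢z (there y∈)  (here refl) = inj₂ (∈-++⁺ˡ (∈-map⁺ _ y∈))
  pairs⁺ y≢z (there y∈)  (there z∈)  with pairs⁺ y≢z y∈ z∈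
  ... | inj₁ p = inj₁ (∈-++⁺ʳ _ p)
  ... | inj₂ p = inj₂ (∈-++⁺ʳ _ p)

  triples-∷ : ∀ {x y z} {xs : List X} → y ≢ z → y ∈ xs → z ∈ xs → Any ((x , y , z) ≈_) (triples (x ∷ xs))
  triples-∷ y≢z y∈ z∈ with pairs⁺ y≢z y∈ z∈
  ... | inj₁ p = lose (∈-++⁺ˡ (∈-map⁺ _ p)) ≈-refl
  ... | inj₂ p = lose (∈-++⁺ˡ (∈-map⁺ _ p)) ≈-swap₂₃

  triples⁺ : ∀ {x y z} {xs : List X} → x ≢ y → y ≢ z → x ≢ z → x ∈ xs → y ∈ xs → z ∈ xs →
             Any ((x , y , z) ≈_) (triples xs)
  triples⁺ x≢y y≢z x≢z (here refl) (here refl) _           = ⊥-elim (x≢y refl)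
  triples⁺ x≢y y≢z x≢z (here refl) (there _)   (here refl) = ⊥-elim (x≢z refl)
  triples⁺ x≢y y≢z x≢z (here refl) (there y∈)  (there z∈)  = triples-∷ y≢z y∈ z∈
  triples⁺ x≢y y≢z x≢z (there _)   (here refl) (here refl) = ⊥-elim (y≢z refl)
  triples⁺ x≢y y≢z x≢z (there x∈)  (here refl) (there z∈)  = Any.map (≈-trans ≈-swap₁₂) (triples-∷ x≢z x∈ z∈)
  triples⁺ x≢y y≢z x≢z (there x∈)  (there y∈)  (here refl) =
    Any.map (≈-trans (≈-trans ≈-swap₂₃ ≈-swap₁₂)) (triples-∷ x≢y x∈ y∈)
  triples⁺ x≢y y≢z x≢z (there x∈)  (there y∈)  (there z∈)  with find (triples⁺ x≢y y≢z x≢z x∈ y∈ z∈)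
  ... | t , t∈ , eq = lose (∈-++⁺ʳ _ t∈) eq

  pairs-unique : ∀ {xs : List X} → Unique xs →
                 AllPairs (λ (y , z) (y′ , z′) → ¬ All (_∈ y′ ∷ z′ ∷ []) (y ∷ z ∷ [])) (pairs xs)
  pairs-unique []                   = []
  pairs-unique {x ∷ xs} (x∉xs ∷ u) = AllPairs.++⁺
    (AllPairs.map⁺ (with-x x∉xs u)) (pairs-unique u)
    (All.map⁺ (All.universal (λ _ → All.tabulate λ yz∈ → λ where
      (0th refl ∷ _) → All.lookup x∉xs (proj₁ (pairs⁻ xs yz∈)) refl
      (1st refl ∷ _) → All.lookup x∉xs (proj₂ (pairs⁻ xs yz∈)) refl) xs))
    where
    with-x : ∀ {ys} → All (x ≢_) ys → Unique ys →
             AllPairs (λ z z′ → ¬ All (_∈ x ∷ z′ ∷ []) (x ∷ z ∷ [])) ys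
    with-x []           []         = []
    with-x (x≢z ∷ x∉ys) (z∉ys ∷ u) =
      All.map (λ z≢z′ → λ where
        (_ ∷ 0th z≡x ∷ [])  → x≢z (sym z≡x)
        (_ ∷ 1st z≡z′ ∷ []) → z≢z′ z≡z′) z∉ys
      ∷ with-x x∉ys u

  -- The head `x` belongs to every triple that starts with it and to no triple of the tail; two
  -- triples with head `x` are told apart by their pairs.
  triples-unique : ∀ {xs : List X} → Unique xs → AllPairs (λ t t′ → ¬ t ⊑ t′) (triples xs)
  triples-unique []                   = []
  triples-unique {x ∷ xs} (x∉xs ∷ u) = AllPairs.++⁺
    (AllPairs.map⁺ (with-x (All.tabulate (λ p → p)) (pairs-unique u))) (triples-unique u)
    (All.map⁺ (All.universal (λ _ → All.tabulate λ t∈ → λ where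
      (x∈t ∷ _) → All.lookup x∉xs (All.lookup (triples⁻ xs t∈) x∈t) refl) (pairs xs)))
    where
    drop-x : ∀ {y y′ z′} → y ∈ xs → y ∈ x ∷ y′ ∷ z′ ∷ [] → y ∈ y′ ∷ z′ ∷ []
    drop-x y∈ (here refl) = ⊥-elim (All.lookup x∉xs y∈ refl)
    drop-x y∈ (there q)   = q

    with-x : ∀ {ps} → All (_∈ pairs xs) ps →
             AllPairs (λ (y , z) (y′ , z′) → ¬ All (_∈ y′ ∷ z′ ∷ []) (y ∷ z ∷ [])) ps →
             AllPairs (λ p p′ → ¬ (x , p) ⊑ (x , p′)) ps
    with-x []         []       = []
    with-x (p∈ ∷ ps∈) (# ∷ #s) =
      All.map (λ ¬⊆ → λ where
        (_ ∷ y∈ ∷ z∈ ∷ []) → ¬⊆ (drop-x (proj₁ (pairs⁻ xs p∈)) y∈ ∷ drop-x (proj₂ (pairs⁻ xs p∈)) z∈ ∷ [])) #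
      ∷ with-x ps∈ #s

-- Counting the edges of a finite substructure.

module _ {X : Set} (S : Str X) where

  IsEdge : Triple X → Set
  IsEdge (x , y , z) = T (R S x y z)

  edges : FinSubset X → List (Triple X)
  edges A = filter (λ (x , y , z) → T? (R S x y z)) (triples (elems A))

  R₁₂ : ∀ {x y z} → T (R S x y z) → T (R S y x z)
  R₁₂ {x} {y} {z} = subst T (R-swap₁₂ S x y z)

  R₂₃ : ∀ {x y z} → T (R S x y z) → T (R S x z y)
  R₂₃ {x} {y} {z} = subst T (R-swap₂₃ S x y z)

  IsEdge-resp : ∀ {x y z x′ y′ z′} → x ≡ x′ → y ≡ y′ → z ≡ z′ → IsEdge (x , y , z) → IsEdge (x′ , y′ , z′)
  IsEdge-resp refl refl refl e = e

  -- The endpoints of an edge are distinct, so the inclusion makes `u` a permutation of `t`, and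
  -- every permutation is a product of the two swaps.
  IsEdge-⊑ : ∀ {t u} → IsEdge t → t ⊑ u → IsEdge u
  IsEdge-⊑ {x , y , z} {p , q , r} e t⊑u with R-distinct S e
  ... | x≢y , y≢z , x≢z = go t⊑u
    where
    go : (x , y , z) ⊑ (p , q , r) → T (R S p q r)
    go (0th refl ∷ 0th refl ∷ _)             = ⊥-elim (x≢y refl)
    go (0th refl ∷ 1st refl ∷ 0th refl ∷ []) = ⊥-elim (x≢z refl)
    go (0th refl ∷ 1st refl ∷ 1st refl ∷ []) = ⊥-elim (y≢z refl)
    go (0th refl ∷ 1st refl ∷ 2nd refl ∷ []) = e
    go (0th refl ∷ 2nd refl ∷ 0th refl ∷ []) = ⊥-elim (x≢z refl)
    go (0th refl ∷ 2nd refl ∷ 1st refl ∷ []) = R₂₃ e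
    go (0th refl ∷ 2nd refl ∷ 2nd refl ∷ []) = ⊥-elim (y≢z refl)
    go (1st refl ∷ 1st refl ∷ _)             = ⊥-elim (x≢y refl)
    go (1st refl ∷ 0th refl ∷ 0th refl ∷ []) = ⊥-elim (y≢z refl)
    go (1st refl ∷ 0th refl ∷ 1st refl ∷ []) = ⊥-elim (x≢z refl)
    go (1st refl ∷ 0th refl ∷ 2nd refl ∷ []) = R₁₂ e
    go (1st refl ∷ 2nd refl ∷ 0th refl ∷ []) = R₁₂ (R₂₃ e)
    go (1st refl ∷ 2nd refl ∷ 1st refl ∷ []) = ⊥-elim (x≢z refl)
    go (1st refl ∷ 2nd refl ∷ 2nd refl ∷ []) = ⊥-elim (y≢z refl)
    go (2nd refl ∷ 2nd refl ∷ _)             = ⊥-elim (x≢y refl)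
    go (2nd refl ∷ 0th refl ∷ 0th refl ∷ []) = ⊥-elim (y≢z refl)
    go (2nd refl ∷ 0th refl ∷ 1st refl ∷ []) = R₂₃ (R₁₂ e)
    go (2nd refl ∷ 0th refl ∷ 2nd refl ∷ []) = ⊥-elim (x≢z refl)
    go (2nd refl ∷ 1st refl ∷ 0th refl ∷ []) = R₁₂ (R₂₃ (R₁₂ e))
    go (2nd refl ∷ 1st refl ∷ 1st refl ∷ []) = ⊥-elim (y≢z refl)
    go (2nd refl ∷ 1st refl ∷ 2nd refl ∷ []) = ⊥-elim (x≢z refl)

  edges⁻ : ∀ {t} A → t ∈ edges A → IsEdge t × All (_∈ elems A) (toList t)
  edges⁻ A t∈ with ∈-filter⁻ _ t∈
  ... | t∈′ , e = e , triples⁻ (elems A) t∈′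

  edges⁺ : ∀ {t} A → IsEdge t → All (_∈ elems A) (toList t) → Any (t ≈_) (edges A)
  edges⁺ A e (x∈ ∷ y∈ ∷ z∈ ∷ []) with R-distinct S e
  ... | x≢y , y≢z , x≢z with find (triples⁺ x≢y y≢z x≢z x∈ y∈ z∈)
  ...   | t , t∈ , t≈ = lose (∈-filter⁺ _ t∈ (IsEdge-⊑ e (proj₁ t≈))) t≈

  edges-unique : ∀ A → AllPairs (λ t u → ¬ t ≈ u) (edges A)
  edges-unique A = AllPairs.filter⁺ _ (AllPairs.map (λ ¬⊑ → ¬⊑ ∘ proj₁) (triples-unique (unique A)))

  ≈-pigeonhole : ∀ {ts us : List (Triple X)} → AllPairs (λ t u → ¬ t ≈ u) ts →
                 (∀ {t} → t ∈ ts → Any (t ≈_) us) → length ts ℕ.≤ length us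
  ≈-pigeonhole # = pigeonhole _≈_ (AllPairs.map (λ ¬≈ _ t≈v u≈v → ¬≈ (≈-trans t≈v (≈-sym u≈v))) #)

  ≤-∣R∣ : ∀ {ts} A → AllPairs (λ t u → ¬ t ≈ u) ts →
          (∀ {t} → t ∈ ts → IsEdge t × All (_∈ elems A) (toList t)) → length ts ℕ.≤ ∣R∣ S A
  ≤-∣R∣ A # ts⊆ = ≈-pigeonhole # λ t∈ → edges⁺ A (proj₁ (ts⊆ t∈)) (proj₂ (ts⊆ t∈))

  ∣R∣-≤ : ∀ {us} A → (∀ {t} → IsEdge t → All (_∈ elems A) (toList t) → Any (t ≈_) us) →
          ∣R∣ S A ℕ.≤ length us
  ∣R∣-≤ A ⊆us = ≈-pigeonhole (edges-unique A) λ t∈ → ⊆us (proj₁ (edges⁻ A t∈)) (proj₂ (edges⁻ A t∈))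

  ∣R∣-mono : ∀ {A B} → A ⊆ B → ∣R∣ S A ℕ.≤ ∣R∣ S B
  ∣R∣-mono {A} {B} A⊆B = ∣R∣-≤ A λ e t⊆A → edges⁺ B e (All.map A⊆B t⊆A)

∣∣-mono : ∀ {X} {A B : FinSubset X} → A ⊆ B → ∣ A ∣ ℕ.≤ ∣ B ∣
∣∣-mono {A = A} A⊆B = length-≤ (λ x → x) (λ eq → eq) (unique A) A⊆B

-- Strong extensions

fromℕ-≃ : ∀ n → ℚ.toℚᵘ (fromℕ n) ≃ᵘ mkℚᵘ (ℤ.+ n) 0
fromℕ-≃ n = ℚ.toℚᵘ-fromℚᵘ (mkℚᵘ (ℤ.+ n) 0)

module Weight (α : ℚ) (a b′ : ℕ) (α≃a/b : ℚ.toℚᵘ α ≃ᵘ mkℚᵘ (ℤ.+ a) b′) where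

  private
    b = suc b′

  δ-≃ : ∀ n r → ℚ.toℚᵘ (fromℕ n ℚ.- α ℚ.* fromℕ r) ≃ᵘ mkℚᵘ (ℤ.+ (b * n) ℤ.- ℤ.+ (a * r)) b′
  δ-≃ n r = begin
    ℚ.toℚᵘ (fromℕ n ℚ.- α ℚ.* fromℕ r)
      ≈⟨ ℚ.toℚᵘ-homo-+ (fromℕ n) (ℚ.- (α ℚ.* fromℕ r)) ⟩
    ℚ.toℚᵘ (fromℕ n) ℚᵘ.+ ℚ.toℚᵘ (ℚ.- (α ℚ.* fromℕ r))
      ≈⟨ ℚᵘ.+-cong (fromℕ-≃ n) (ℚᵘ.≃-trans (ℚ.toℚᵘ-homo‿- (α ℚ.* fromℕ r))
           (ℚᵘ.-‿cong (ℚᵘ.≃-trans (ℚ.toℚᵘ-homo-* α (fromℕ r)) (ℚᵘ.*-cong α≃a/b (fromℕ-≃ r))))) ⟩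
    mkℚᵘ (ℤ.+ n) 0 ℚᵘ.- mkℚᵘ (ℤ.+ a) b′ ℚᵘ.* mkℚᵘ (ℤ.+ r) 0
      ≈⟨ ℚᵘ.*≡* eq ⟩
    mkℚᵘ (ℤ.+ (b * n) ℤ.- ℤ.+ (a * r)) b′ ∎
    where
    open ℚᵘ.≃-Reasoning
    eq : ((ℤ.+ n) ℤ.* ℚᵘ.↧ (mkℚᵘ (ℤ.+ a) b′ ℚᵘ.* mkℚᵘ (ℤ.+ r) 0)
           ℤ.+ (ℤ.- (ℤ.+ a ℤ.* ℤ.+ r)) ℤ.* ℤ.+ 1) ℤ.* ℤ.+ b
         ≡ (ℤ.+ (b * n) ℤ.- ℤ.+ (a * r)) ℤ.* ℚᵘ.↧ (mkℚᵘ (ℤ.+ n) 0 ℚᵘ.- mkℚᵘ (ℤ.+ a) b′ ℚᵘ.* mkℚᵘ (ℤ.+ r) 0)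
    eq rewrite ℕ.*-identityʳ b′ | ℕ.+-identityʳ b′ | ℤ.pos-* b n | ℤ.pos-* a r =
      lemma (ℤ.+ n) (ℤ.+ b) (ℤ.+ a) (ℤ.+ r)
      where
      lemma : ∀ n b a r → (n ℤ.* b ℤ.+ (ℤ.- (a ℤ.* r)) ℤ.* ℤ.+ 1) ℤ.* b ≡ (b ℤ.* n ℤ.- a ℤ.* r) ℤ.* b
      lemma = ℤ.solve-∀

  δ-<⁻ : ∀ n r n′ r′ → fromℕ n ℚ.- α ℚ.* fromℕ r ℚ.< fromℕ n′ ℚ.- α ℚ.* fromℕ r′ →
         b * n + a * r′ ℕ.< b * n′ + a * r
  δ-<⁻ n r n′ r′ lt = ℤ.drop‿+<+ (subst₂ ℤ._<_
      (lemma (ℤ.+ (b * n)) (ℤ.+ (a * r)) (ℤ.+ (a * r′))) (lemma′ (ℤ.+ (b * n′)) (ℤ.+ (a * r′)) (ℤ.+ (a * r)))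
      (ℤ.+-monoˡ-< (ℤ.+ (a * r) ℤ.+ ℤ.+ (a * r′))
        (ℤ.*-cancelʳ-<-nonNeg {ℤ.+ (b * n) ℤ.- ℤ.+ (a * r)} {ℤ.+ (b * n′) ℤ.- ℤ.+ (a * r′)} (ℤ.+ b)
          (ℚᵘ.drop-*<* (ℚᵘ.<-respˡ-≃ (δ-≃ n r) (ℚᵘ.<-respʳ-≃ (δ-≃ n′ r′) (ℚ.toℚᵘ-mono-< lt)))))))
    where
    lemma : ∀ x y z → x ℤ.- y ℤ.+ (y ℤ.+ z) ≡ x ℤ.+ z
    lemma = ℤ.solve-∀
    lemma′ : ∀ x y z → x ℤ.- y ℤ.+ (z ℤ.+ y) ≡ x ℤ.+ z
    lemma′ = ℤ.solve-∀

  δ-<⁺ : ∀ n r n′ r′ → b * n + a * r′ ℕ.< b * n′ + a * r →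
         fromℕ n ℚ.- α ℚ.* fromℕ r ℚ.< fromℕ n′ ℚ.- α ℚ.* fromℕ r′
  δ-<⁺ n r n′ r′ lt =
    ℚ.toℚᵘ-cancel-< (ℚᵘ.<-respˡ-≃ (ℚᵘ.≃-sym (δ-≃ n r)) (ℚᵘ.<-respʳ-≃ (ℚᵘ.≃-sym (δ-≃ n′ r′))
      (ℚᵘ.*<* (ℤ.*-monoʳ-<-pos (ℤ.+ b) (subst₂ ℤ._<_
        (lemma (ℤ.+ (b * n)) (ℤ.+ (a * r)) (ℤ.+ (a * r′))) (lemma′ (ℤ.+ (b * n′)) (ℤ.+ (a * r′)) (ℤ.+ (a * r)))
        (ℤ.+-monoˡ-< (ℤ.- (ℤ.+ (a * r) ℤ.+ ℤ.+ (a * r′))) (ℤ.+<+ lt)))))))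
    where
    lemma : ∀ x y z → x ℤ.+ z ℤ.+ (ℤ.- (y ℤ.+ z)) ≡ x ℤ.- y
    lemma = ℤ.solve-∀
    lemma′ : ∀ x y z → x ℤ.+ z ℤ.+ (ℤ.- (z ℤ.+ y)) ≡ x ℤ.- y
    lemma′ = ℤ.solve-∀

-- Submodularity of δ and transitivity of ≤*.

length-filter-¬ : ∀ {A : Set} {P : A → Set} (P? : Decidable P) xs →
                  length (filter P? xs) + length (filter (¬? ∘ P?) xs) ≡ length xs
length-filter-¬ P? []       = refl
length-filter-¬ P? (x ∷ xs) with P? x
... | yes _ = cong suc (length-filter-¬ P? xs)
... | no  _ = trans (ℕ.+-suc _ _) (cong suc (length-filter-¬ P? xs))

module Weighted (α : ℚ) (a b′ : ℕ) (α≃a/b : ℚ.toℚᵘ α ≃ᵘ mkℚᵘ (ℤ.+ a) b′)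
                {X : Set} (_≟_ : DecidableEquality X) (S : Str X) where

  private
    b = suc b′
  open Weight α a b′ α≃a/b using (δ-<⁻; δ-<⁺)
  open DecMembership _≟_ using (_∈?_)

  -- δ A ≤ δ B and δ A < δ B, multiplied by the denominator of α and with the
  -- negative terms moved to the other side.
  _≼_ _≺_ : FinSubset X → FinSubset X → Set
  A ≼ B = b * ∣ A ∣ + a * ∣R∣ S B ℕ.≤ b * ∣ B ∣ + a * ∣R∣ S A
  A ≺ B = b * ∣ A ∣ + a * ∣R∣ S B ℕ.< b * ∣ B ∣ + a * ∣R∣ S A

  ≼-≺-trans : ∀ {A B C} → A ≼ B → B ≺ C → A ≺ C
  ≼-≺-trans {A} {B} {C} p q = ℕ.+-cancelʳ-< (b * ∣ B ∣ + a * ∣R∣ S B) _ _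
    (subst₂ ℕ._<_ (l₁ (b * ∣ A ∣) (a * ∣R∣ S B) (b * ∣ B ∣) (a * ∣R∣ S C))
                  (l₂ (b * ∣ B ∣) (a * ∣R∣ S A) (b * ∣ C ∣) (a * ∣R∣ S B))
      (ℕ.+-mono-≤-< p q))
    where
    l₁ : ∀ x y z w → x + y + (z + w) ≡ x + w + (z + y)
    l₁ = ℕ.solve-∀
    l₂ : ∀ x y z w → x + y + (z + w) ≡ z + y + (x + w)
    l₂ = ℕ.solve-∀

  -- Lists with the same elements may differ in order, so equality of subsets is replaced by
  -- equality of weights, of which this is one half.
  ⊆-antisym-≼ : ∀ {A B} → A ⊆ B → B ⊆ A → A ≼ B
  ⊆-antisym-≼ {A} {B} A⊆B B⊆A = ℕ.+-mono-≤ (ℕ.*-monoʳ-≤ b (∣∣-mono {A = A} {B} A⊆B))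
                                        (ℕ.*-monoʳ-≤ a (∣R∣-mono S {B} {A} B⊆A))

  _⊆?_ : ∀ A B → Dec (A ⊆ B)
  A ⊆? B = map′ (λ p → All.lookup p) (λ A⊆B → All.tabulate A⊆B) (all? (_∈? elems B) (elems A))

  infixl 7 _∩_ _∖_
  infixl 6 _∪_

  _∩_ _∖_ _∪_ : FinSubset X → FinSubset X → FinSubset X
  A ∩ B = ⟨ filter (_∈? elems B) (elems A) , Unique.filter⁺ _ (unique A) ⟩
  A ∖ B = ⟨ filter (¬? ∘ (_∈? elems B)) (elems A) , Unique.filter⁺ _ (unique A) ⟩
  A ∪ B = ⟨ elems B ++ elems (A ∖ B)
          , Unique.++⁺ (unique B) (unique (A ∖ B)) (λ (x∈B , x∈A∖B) →
              proj₂ (∈-filter⁻ (¬? ∘ (_∈? elems B)) {xs = elems A} x∈A∖B) x∈B) ⟩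

  ⊆-∪ˡ : ∀ {A B} → A ⊆ (A ∪ B)
  ⊆-∪ˡ {A} {B} {x} x∈A with x ∈? elems B
  ... | yes x∈B = ∈-++⁺ˡ x∈B
  ... | no  x∉B = ∈-++⁺ʳ (elems B) (∈-filter⁺ _ x∈A x∉B)

  ∪-⊆ : ∀ {A B C} → A ⊆ C → B ⊆ C → (A ∪ B) ⊆ C
  ∪-⊆ {A} {B} A⊆C B⊆C x∈ with ∈-++⁻ (elems B) x∈
  ... | inj₁ x∈B = B⊆C x∈B
  ... | inj₂ x∈A = A⊆C (proj₁ (∈-filter⁻ _ x∈A))

  -- The edges of `A` that lie inside `B` are edges of `A ∩ B`. The others are distinct from the
  -- edges of `B`, and together with them are edges of `A ∪ B`.
  ∣R∣-submodular : ∀ A B → ∣R∣ S A + ∣R∣ S B ℕ.≤ ∣R∣ S (A ∪ B) + ∣R∣ S (A ∩ B)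
  ∣R∣-submodular A B = begin
    ∣R∣ S A + ∣R∣ S B
      ≡⟨ cong (_+ ∣R∣ S B) (length-filter-¬ inside? (edges S A)) ⟨
    length (filter inside? (edges S A)) + length outside + ∣R∣ S B
      ≤⟨ ℕ.+-monoˡ-≤ (∣R∣ S B) (ℕ.+-monoˡ-≤ (length outside) (≤-∣R∣ S (A ∩ B)
           (AllPairs.filter⁺ inside? (edges-unique S A)) inside⊆)) ⟩
    ∣R∣ S (A ∩ B) + length outside + ∣R∣ S B
      ≡⟨ ℕ.+-assoc (∣R∣ S (A ∩ B)) _ _ ⟩
    ∣R∣ S (A ∩ B) + (length outside + ∣R∣ S B)
      ≡⟨ cong (λ n → ∣R∣ S (A ∩ B) + n) (length-++ outside) ⟨
    ∣R∣ S (A ∩ B) + length (outside ++ edges S B)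
      ≤⟨ ℕ.+-monoʳ-≤ (∣R∣ S (A ∩ B)) (≤-∣R∣ S (A ∪ B) distinct ⊆∪) ⟩
    ∣R∣ S (A ∩ B) + ∣R∣ S (A ∪ B)
      ≡⟨ ℕ.+-comm (∣R∣ S (A ∩ B)) _ ⟩
    ∣R∣ S (A ∪ B) + ∣R∣ S (A ∩ B) ∎
    where
    open ℕ.≤-Reasoning
    inside? : Decidable (λ t → All (_∈ elems B) (toList t))
    inside? t = all? (_∈? elems B) (toList t)
    outside = filter (¬? ∘ inside?) (edges S A)

    inside⊆ : ∀ {t} → t ∈ filter inside? (edges S A) → IsEdge S t × All (_∈ elems (A ∩ B)) (toList t)
    inside⊆ t∈ with ∈-filter⁻ inside? t∈
    ... | t∈A , t⊆B with edges⁻ S A t∈A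
    ...   | e , t⊆A = e , All.tabulate λ x∈ → ∈-filter⁺ _ (All.lookup t⊆A x∈) (All.lookup t⊆B x∈)

    distinct : AllPairs (λ t u → ¬ t ≈ u) (outside ++ edges S B)
    distinct = AllPairs.++⁺ (AllPairs.filter⁺ _ (edges-unique S A)) (edges-unique S B)
      (All.tabulate λ t∈ → All.tabulate λ u∈ t≈u → proj₂ (∈-filter⁻ (¬? ∘ inside?) {xs = edges S A} t∈)
        (All.map (All.lookup (proj₂ (edges⁻ S B u∈))) (proj₁ t≈u)))

    ⊆∪ : ∀ {t} → t ∈ outside ++ edges S B → IsEdge S t × All (_∈ elems (A ∪ B)) (toList t)
    ⊆∪ t∈ with ∈-++⁻ outside t∈
    ... | inj₁ t∈o = map₂ (All.map (⊆-∪ˡ {A} {B})) (edges⁻ S A (proj₁ (∈-filter⁻ _ t∈o)))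
    ... | inj₂ t∈B = map₂ (All.map ∈-++⁺ˡ) (edges⁻ S B t∈B)

  -- By submodularity, `A` gains over `A ∩ B` at least as much weight as `A ∪ B` gains over `B`.
  ∩-≺ : ∀ {A B} → B ≺ (A ∪ B) → (A ∩ B) ≺ A
  ∩-≺ {A} {B} lt = ℕ.+-cancelʳ-< (b * ∣ B ∣ + a * ∣R∣ S (A ∪ B)) _ _ (begin-strict
    b * ∣ A ∩ B ∣ + a * ∣R∣ S A + (b * ∣ B ∣ + a * ∣R∣ S (A ∪ B))
      <⟨ ℕ.+-monoʳ-< (b * ∣ A ∩ B ∣ + a * ∣R∣ S A) lt ⟩
    b * ∣ A ∩ B ∣ + a * ∣R∣ S A + (b * ∣ A ∪ B ∣ + a * ∣R∣ S B)
      ≡⟨ cong (λ n → b * ∣ A ∩ B ∣ + a * ∣R∣ S A + (b * n + a * ∣R∣ S B)) (length-++ (elems B)) ⟩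
    b * ∣ A ∩ B ∣ + a * ∣R∣ S A + (b * (∣ B ∣ + ∣ A ∖ B ∣) + a * ∣R∣ S B)
      ≡⟨ l₁ b a (∣ A ∩ B ∣) (∣R∣ S A) (∣ B ∣) (∣ A ∖ B ∣) (∣R∣ S B) ⟩
    b * (∣ A ∩ B ∣ + ∣ A ∖ B ∣) + b * ∣ B ∣ + a * (∣R∣ S A + ∣R∣ S B)
      ≡⟨ cong (λ n → b * n + b * ∣ B ∣ + a * (∣R∣ S A + ∣R∣ S B)) (length-filter-¬ (_∈? elems B) (elems A)) ⟩
    b * ∣ A ∣ + b * ∣ B ∣ + a * (∣R∣ S A + ∣R∣ S B)
      ≤⟨ ℕ.+-monoʳ-≤ (b * ∣ A ∣ + b * ∣ B ∣) (ℕ.*-monoʳ-≤ a (∣R∣-submodular A B)) ⟩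
    b * ∣ A ∣ + b * ∣ B ∣ + a * (∣R∣ S (A ∪ B) + ∣R∣ S (A ∩ B))
      ≡⟨ l₂ b a (∣ A ∣) (∣ B ∣) (∣R∣ S (A ∪ B)) (∣R∣ S (A ∩ B)) ⟩
    b * ∣ A ∣ + a * ∣R∣ S (A ∩ B) + (b * ∣ B ∣ + a * ∣R∣ S (A ∪ B)) ∎)
    where
    open ℕ.≤-Reasoning
    l₁ : ∀ b a i r n d s → b * i + a * r + (b * (n + d) + a * s) ≡ b * (i + d) + b * n + a * (r + s)
    l₁ = ℕ.solve-∀
    l₂ : ∀ b a n m r s → b * n + b * m + a * (r + s) ≡ b * n + a * s + (b * m + a * r)
    l₂ = ℕ.solve-∀

  strong⁻ : ∀ {A B C} → Strong α S A B → A ⊊ C → C ⊆ B → A ≺ C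
  strong⁻ {A} {B} {C} sAB A⊊C C⊆B = δ-<⁻ (∣ A ∣) (∣R∣ S A) (∣ C ∣) (∣R∣ S C) (proj₂ sAB C A⊊C C⊆B)

  strong⁺ : ∀ {A B} → A ⊆ B → (∀ C → A ⊊ C → C ⊆ B → A ≺ C) → Strong α S A B
  strong⁺ {A} {B} A⊆B s = A⊆B , λ C A⊊C C⊆B → δ-<⁺ (∣ A ∣) (∣R∣ S A) (∣ C ∣) (∣R∣ S C) (s C A⊊C C⊆B)

  strong⇒≼ : ∀ {A B C} → Strong α S A B → A ⊆ C → C ⊆ B → A ≼ C
  strong⇒≼ {A} {B} {C} sAB A⊆C C⊆B =
    [ ⊆-antisym-≼ {A} {C} A⊆C , (λ C⊈A → ℕ.<⇒≤ (strong⁻ {A} {B} {C} sAB (A⊆C , C⊈A) C⊆B)) ]′ (toSum (C ⊆? A))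

  -- A set `D` that leaves `B` is reached through `D ∩ B`. The step from `A` to `D ∩ B` loses no
  -- weight, and the step from there to `D` gains some, since `D ∪ B` properly extends `B` inside
  -- `C`.
  strong-trans : ∀ {A B C} → Strong α S A B → Strong α S B C → Strong α S A C
  strong-trans {A} {B} {C} sAB sBC = strong⁺ {A} {C} (proj₁ sBC ∘ proj₁ sAB) λ D A⊊D D⊆C →
    [ strong⁻ {A} {B} {D} sAB A⊊D
    , (λ D⊈B → ≼-≺-trans {A} {D ∩ B} {D}
        (strong⇒≼ {A} {B} {D ∩ B} sAB
          (λ x∈A → ∈-filter⁺ (_∈? elems B) (proj₁ A⊊D x∈A) (proj₁ sAB x∈A))
          (λ x∈ → proj₂ (∈-filter⁻ (_∈? elems B) {xs = elems D} x∈)))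
        (∩-≺ {D} {B} (strong⁻ {B} {C} {D ∪ B} sBC
          ((λ x∈B → ∈-++⁺ˡ x∈B) , λ ∪⊆B → D⊈B (λ x∈ → ∪⊆B (⊆-∪ˡ {D} {B} x∈)))
          (∪-⊆ {D} {B} {C} D⊆C (proj₁ sBC)))))
    ]′ (toSum (D ⊆? B))

  module Chain (A : ℕ → FinSubset X) (A≤A : ∀ i → Strong α S (A i) (A (suc i))) where

    strong-+ : ∀ d i → Strong α S (A i) (A (d + i))
    strong-+ zero    i = (λ x∈ → x∈) , λ C (_ , C⊈A) C⊆A → ⊥-elim (C⊈A C⊆A)
    strong-+ (suc d) i = strong-trans {A i} {A (d + i)} {A (suc (d + i))} (strong-+ d i) (A≤A (d + i))

    strong-≤ : ∀ {i j} → i ℕ.≤ j → Strong α S (A i) (A j)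
    strong-≤ {i} {j} i≤j = subst (λ k → Strong α S (A i) (A k)) (ℕ.m∸n+n≡m i≤j) (strong-+ _ i)

    module _ (covers : ∀ x → ∃[ i ] x ∈ elems (A i)) where

      covers-list : ∀ xs → ∃[ i ] All (_∈ elems (A i)) xs
      covers-list []       = 0 , []
      covers-list (x ∷ xs) with covers x | covers-list xs
      ... | i , x∈ | j , xs⊆ = i ⊔ j , proj₁ (strong-≤ (ℕ.m≤m⊔n i j)) x∈
                                     ∷ All.map (proj₁ (strong-≤ (ℕ.m≤n⊔m i j))) xs⊆

      -- A finite `B` is contained in some member of the chain, and strength is transitive along the
      -- chain. With `covers-list`, this places every finite tuple in a finite strong set.
      strongIn : ∀ i → StrongIn α S (A i)
      strongIn i B A⊆B with covers-list (elems B)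
      ... | j , B⊆Aj = A⊆B , λ C A⊊C C⊆B → proj₂ (strong-≤ (ℕ.m≤m⊔n i j)) C A⊊C
                         (λ x∈ → proj₁ (strong-≤ (ℕ.m≤n⊔m i j)) (All.lookup B⊆Aj (C⊆B x∈)))

-- Gadgets

length-cartesianProduct : ∀ {A B : Set} (xs : List A) (ys : List B) →
                          length (cartesianProduct xs ys) ≡ length xs * length ys
length-cartesianProduct []       ys = refl
length-cartesianProduct (x ∷ xs) ys = trans (length-++ (map (x ,_) ys))
  (cong₂ _+_ (length-map (x ,_) ys) (length-cartesianProduct xs ys))

length-allFin : ∀ n → length (allFin n) ≡ n
length-allFin n = length-tabulate (λ i → i)

length-×-allFin : ∀ {A : Set} (xs : List A) n → length (cartesianProduct xs (allFin n)) ≡ length xs * n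
length-×-allFin xs n = trans (length-cartesianProduct xs (allFin n)) (cong (length xs *_) (length-allFin n))

abstract
  -- A row of m n unit cells, cut into m blocks of length n, is cut again into n
  -- blocks of length m.
  recut : ∀ {m n} → Fin m × Fin n → Fin n × Fin m
  recut {m} {n} (j , k) = Fin.remQuot m (Fin.cast (ℕ.*-comm m n) (Fin.combine j k))

  recut-involutive : ∀ {m n} (x : Fin m × Fin n) → recut (recut x) ≡ x
  recut-involutive {m} {n} (j , k) = begin
    Fin.remQuot n (Fin.cast (ℕ.*-comm n m) (uncurry Fin.combine (Fin.remQuot {n} m t)))
      ≡⟨ cong (λ c → Fin.remQuot n (Fin.cast (ℕ.*-comm n m) c)) (Fin.combine-remQuot {n} m t) ⟩
    Fin.remQuot n (Fin.cast (ℕ.*-comm n m) t)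
      ≡⟨ cong (Fin.remQuot n) (Fin.cast-involutive (ℕ.*-comm n m) (ℕ.*-comm m n) (Fin.combine j k)) ⟩
    Fin.remQuot n (Fin.combine j k)
      ≡⟨ Fin.remQuot-combine j k ⟩
    (j , k) ∎
    where
    open ≡-Reasoning
    t : Fin (n * m)
    t = Fin.cast (ℕ.*-comm m n) (Fin.combine j k)

  recut-injective : ∀ {m n} → Injective _≡_ _≡_ (recut {m} {n})
  recut-injective {x = x} {y} eq = trans (sym (recut-involutive x)) (trans (cong recut eq) (recut-involutive y))

  toℕ-recut : ∀ {m n} (j : Fin m) (k : Fin n) →
              let i , l = recut (j , k) in m * toℕ i + toℕ l ≡ n * toℕ j + toℕ k
  toℕ-recut {m} {n} j k = trans (sym (Fin.toℕ-combine i l))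
    (trans (cong toℕ (Fin.combine-remQuot {n} m (Fin.cast (ℕ.*-comm m n) (Fin.combine j k))))
    (trans (Fin.toℕ-cast (ℕ.*-comm m n) (Fin.combine j k)) (Fin.toℕ-combine j k)))
    where
    i : Fin n
    i = proj₁ (recut (j , k))
    l : Fin m
    l = proj₂ (recut (j , k))

module Gadget (a′ b′ : ℕ) (a≤b : suc a′ ℕ.≤ suc b′) where

  a = suc a′
  b = suc b′

  Slot : Set
  Slot = Fin a ⊎ Fin (suc b)

  -- On a row of a b cells, the j-th edge owns the cells from j a to (j + 1) a − 1
  -- and the point E i owns those from i b to (i + 1) b − 1.  As a ≤ b, the cells of
  -- edge j belong to at most two points: hi j, the owner of its last cell, and the
  -- point before hi j, which is lo j.  (For hi j = 0, lo j is the base point u.)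
  hi : Fin b → Fin a
  hi j = proj₁ (recut (j , Fin.fromℕ a′))

  pre : Fin a → Slot
  pre zero    = inj₂ zero
  pre (suc i) = inj₁ (inject₁ i)

  lo : Fin b → Slot
  lo j = pre (hi j)

  toℕ-hi : ∀ j → b * toℕ (hi j) + toℕ (proj₂ (recut (j , Fin.fromℕ a′))) ≡ a * toℕ j + a′
  toℕ-hi j = trans (toℕ-recut j (Fin.fromℕ a′)) (cong (λ n → a * toℕ j + n) (Fin.toℕ-fromℕ a′))

  -- The first edge owns the cells 0 to a - 1, and `a ≤ b` puts them all in the block of `E 0`.
  -- Hence the first edge joins `P 0`, `E 0` and `P 1`; links are later read off from this edge.
  hi-zero : hi zero ≡ zero
  hi-zero = Fin.toℕ-injective (ℕ.n<1⇒n≡0 (ℕ.*-cancelˡ-< b _ _ (begin-strict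
    b * toℕ (hi zero)             ≤⟨ ℕ.m≤m+n _ _ ⟩
    b * toℕ (hi zero) + toℕ l     ≡⟨ toℕ-hi zero ⟩
    a * 0 + a′                    ≡⟨ cong (_+ a′) (ℕ.*-zeroʳ a) ⟩
    a′                            <⟨ a≤b ⟩
    b                             ≡⟨ ℕ.*-identityʳ b ⟨
    b * 1                         ∎)))
    where
    open ℕ.≤-Reasoning
    l = proj₂ (recut {b} {a} (zero , Fin.fromℕ a′))

  lo-zero : lo zero ≡ inj₂ zero
  lo-zero = cong pre hi-zero

  pre-suc : ∀ i i′ → toℕ i′ ≡ suc (toℕ i) → pre i′ ≡ inj₁ i
  pre-suc i (suc i′) eq = cong inj₁ (Fin.toℕ-injective (trans (Fin.toℕ-inject₁ i′) (ℕ.suc-injective eq)))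

  -- The last cell of the edge is not before cell `k`, so its owner is not before `i`. It is fewer
  -- than `b` cells further on, so its owner is at most one point later.
  cell-∈ : ∀ j k → let i = proj₁ (recut {b} {a} (j , k)) in inj₁ i ≡ lo j ⊎ i ≡ hi j
  cell-∈ j k with ℕ.m≤n⇒m<n∨m≡n i≤hi
    where
    open ℕ.≤-Reasoning
    i = proj₁ (recut {b} {a} (j , k))
    l = proj₂ (recut {b} {a} (j , k))
    l′ = proj₂ (recut {b} {a} (j , Fin.fromℕ a′))
    i≤hi : toℕ i ℕ.≤ toℕ (hi j)
    i≤hi = ℕ.m<1+n⇒m≤n (ℕ.*-cancelˡ-< b _ _ (begin-strict
      b * toℕ i                   ≤⟨ ℕ.m≤m+n _ _ ⟩
      b * toℕ i + toℕ l           ≡⟨ toℕ-recut j k ⟩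
      a * toℕ j + toℕ k           ≤⟨ ℕ.+-monoʳ-≤ (a * toℕ j) (ℕ.m<1+n⇒m≤n (Fin.toℕ<n k)) ⟩
      a * toℕ j + a′              ≡⟨ toℕ-hi j ⟨
      b * toℕ (hi j) + toℕ l′     <⟨ ℕ.+-monoʳ-< (b * toℕ (hi j)) (Fin.toℕ<n l′) ⟩
      b * toℕ (hi j) + b          ≡⟨ ℕ.+-comm _ b ⟩
      b + b * toℕ (hi j)          ≡⟨ ℕ.*-suc b _ ⟨
      b * suc (toℕ (hi j))        ∎))
  ... | inj₂ i≡hi = inj₂ (Fin.toℕ-injective i≡hi)
  ... | inj₁ i<hi = inj₁ (sym (pre-suc i (hi j) (ℕ.≤-antisym hi≤1+i i<hi)))
    where
    open ℕ.≤-Reasoning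
    i = proj₁ (recut {b} {a} (j , k))
    l = proj₂ (recut {b} {a} (j , k))
    l′ = proj₂ (recut {b} {a} (j , Fin.fromℕ a′))
    hi≤1+i : toℕ (hi j) ℕ.≤ suc (toℕ i)
    hi≤1+i = ℕ.m<1+n⇒m≤n (ℕ.*-cancelˡ-< b _ _ (begin-strict
      b * toℕ (hi j)              ≤⟨ ℕ.m≤m+n _ _ ⟩
      b * toℕ (hi j) + toℕ l′     ≡⟨ toℕ-hi j ⟩
      a * toℕ j + a′              ≤⟨ ℕ.+-monoˡ-≤ a′ (ℕ.m≤m+n _ (toℕ k)) ⟩
      a * toℕ j + toℕ k + a′      ≡⟨ cong (_+ a′) (toℕ-recut j k) ⟨
      b * toℕ i + toℕ l + a′      <⟨ ℕ.+-mono-<-≤ (ℕ.+-monoʳ-< (b * toℕ i) (Fin.toℕ<n l)) (ℕ.<⇒≤ a≤b) ⟩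
      b * toℕ i + b + b           ≡⟨ ℕ.+-comm _ b ⟩
      b + (b * toℕ i + b)         ≡⟨ cong (b +_) (trans (ℕ.+-comm _ b) (sym (ℕ.*-suc b _))) ⟩
      b + b * suc (toℕ i)         ≡⟨ ℕ.*-suc b _ ⟨
      b * suc (suc (toℕ i))       ∎))

  lo≢suc : ∀ j {j′} → lo j ≢ inj₂ (suc j′)
  lo≢suc j eq with hi j
  lo≢suc j () | zero
  lo≢suc j () | suc _

  lo≢hi : ∀ j → lo j ≢ inj₁ (hi j)
  lo≢hi j eq with hi j
  lo≢hi j () | zero
  lo≢hi j eq | suc i = ℕ.1+n≢n (trans (cong toℕ (sym (inj₁-injective eq))) (Fin.toℕ-inject₁ i))

  -- The base P lists u = P 0 and q_j = P (suc j).
  edge : ∀ {X : Set} → (Slot → X) → Fin b → Triple X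
  edge w j = w (lo j) , w (inj₁ (hi j)) , w (inj₂ (suc j))

  -- Only the presence of the edges is required. Further edges among the points can only lower `δ`,
  -- so strong sets are closed under these gadgets as well.
  Gad : ∀ {X} → Str X → (Fin (suc b) → X) → (Fin a → X) → Set
  Gad S P E = Injective _≡_ _≡_ [ E , P ]′ × (∀ j → IsEdge S (edge [ E , P ]′ j))

  -- Strong sets are closed under gadgets.

  module Closed (α : ℚ) (α≃a/b : ℚ.toℚᵘ α ≃ᵘ mkℚᵘ (ℤ.+ a) b′) {X : Set} (_≟_ : DecidableEquality X) (S : Str X) where

    open Weighted α a b′ α≃a/b _≟_ S
    open DecMembership _≟_ using (_∈?_)

    module _ (B : FinSubset X) {P E} (P∈B : ∀ p → P p ∈ elems B) (G : Gad S P E) where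

      private
        w = [ E , P ]′
        w-injective = proj₁ G

        new? : Decidable (λ i → E i ∉ elems B)
        new? i = ¬? (E i ∈? elems B)
        new = filter new? (allFin a)

        inside? : Decidable (λ j → w (lo j) ∈ elems B × E (hi j) ∈ elems B)
        inside? j = (w (lo j) ∈? elems B) ×-dec (E (hi j) ∈? elems B)

        meeting? = ¬? ∘ inside?
        meeting = filter meeting? (allFin b)

        new⁻ : ∀ {i} → i ∈ new → E i ∉ elems B
        new⁻ i∈ = proj₂ (∈-filter⁻ new? {xs = allFin a} i∈)

        -- The edge to which a cell of a missing point belongs has that point as its `lo` or `hi`
        -- vertex, by `cell-∈`, so it is not inside `B`. Recutting thus sends the cells of missing
        -- points injectively to cells of edges in `meeting`.
        cells : length new * b ℕ.≤ length meeting * a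
        cells = subst₂ ℕ._≤_
          (length-×-allFin new b) (length-×-allFin meeting a)
          (length-≤ recut recut-injective
            (Unique.cartesianProduct⁺ (Unique.filter⁺ new? (Unique.allFin⁺ a)) (Unique.allFin⁺ b))
            (λ {(i , l)} il∈ → ∈-cartesianProduct⁺
              (∈-filter⁺ meeting? (∈-allFin _)
                (outside (recut (i , l)) (cong proj₁ (recut-involutive (i , l)))
                  (new⁻ (proj₁ (∈-cartesianProduct⁻ new (allFin b) il∈)))))
              (∈-allFin _)))
          where
          outside : ∀ {i} (jk : Fin b × Fin a) → proj₁ (recut jk) ≡ i → E i ∉ elems B →
                    ¬ (w (lo (proj₁ jk)) ∈ elems B × E (hi (proj₁ jk)) ∈ elems B)
          outside (j , k) refl Ei∉ (lo∈ , hi∈) with cell-∈ j k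
          ... | inj₁ eq = Ei∉ (subst (λ s → w s ∈ elems B) (sym eq) lo∈)
          ... | inj₂ eq = Ei∉ (subst (λ i → E i ∈ elems B) (sym eq) hi∈)

        C : FinSubset X
        C = ⟨ elems B ++ map E new
            , Unique.++⁺ (unique B)
                (Unique.map⁺ (λ eq → inj₁-injective (w-injective {inj₁ _} {inj₁ _} eq))
                  (Unique.filter⁺ new? (Unique.allFin⁺ a)))
                disjoint ⟩
          where
          disjoint : ∀ {x} → ¬ (x ∈ elems B × x ∈ map E new)
          disjoint (x∈B , x∈new) with ∈-map⁻ E x∈new
          ... | i , i∈ , refl = new⁻ i∈ x∈B

        w∈C : ∀ s → w s ∈ elems C
        w∈C (inj₂ p) = ∈-++⁺ˡ (P∈B p)
        w∈C (inj₁ i) with E i ∈? elems B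
        ... | yes Ei∈B = ∈-++⁺ˡ Ei∈B
        ... | no  Ei∉B = ∈-++⁺ʳ (elems B) (∈-map⁺ E (∈-filter⁺ new? (∈-allFin i) Ei∉B))

        -- Several edges may share both `lo` and `hi`. What separates them is the base point `q_j`,
        -- which lies on no other edge of the gadget.
        edge-injective : ∀ {j j′} → edge w j ≈ edge w j′ → j ≡ j′
        edge-injective {j} {j′} ((_ ∷ _ ∷ q∈ ∷ []) , _) = go q∈
          where
          go : w (inj₂ (suc j)) ∈ toList (edge w j′) → j ≡ j′
          go (0th eq) = ⊥-elim (lo≢suc j′ (sym (w-injective eq)))
          go (1st eq) with () ← w-injective {inj₂ (suc j)} {inj₁ (hi j′)} eq
          go (2nd eq) = Fin.suc-injective (inj₂-injective (w-injective {inj₂ (suc j)} {inj₂ (suc j′)} eq))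

        ∣R∣-C : length meeting + ∣R∣ S B ℕ.≤ ∣R∣ S C
        ∣R∣-C = subst (ℕ._≤ ∣R∣ S C)
          (trans (length-++ (map (edge w) meeting)) (cong (_+ ∣R∣ S B) (length-map (edge w) meeting)))
          (≤-∣R∣ S C
            (AllPairs.++⁺
              (AllPairs.map⁺ (AllPairs.map (λ j≢j′ eq → j≢j′ (edge-injective eq))
                (Unique.filter⁺ meeting? (Unique.allFin⁺ b))))
              (edges-unique S B)
              (All.map⁺ (All.tabulate λ {j} j∈ → All.tabulate λ t∈ eq → not-in-B j∈ t∈ eq)))
            ts⊆C)
          where
          not-in-B : ∀ {j t} → j ∈ meeting → t ∈ edges S B → ¬ edge w j ≈ t
          not-in-B j∈ t∈ ((lo∈ ∷ hi∈ ∷ _) , _) =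
            proj₂ (∈-filter⁻ meeting? {xs = allFin b} j∈) (All.lookup t⊆B lo∈ , All.lookup t⊆B hi∈)
            where t⊆B = proj₂ (edges⁻ S B t∈)
          ts⊆C : ∀ {t} → t ∈ map (edge w) meeting ++ edges S B → IsEdge S t × All (_∈ elems C) (toList t)
          ts⊆C t∈ with ∈-++⁻ (map (edge w) meeting) t∈
          ... | inj₂ t∈B = map₂ (All.map ∈-++⁺ˡ) (edges⁻ S B t∈B)
          ... | inj₁ t∈m with ∈-map⁻ (edge w) t∈m
          ...   | j , _ , refl = proj₂ G j , (w∈C (lo j) ∷ w∈C (inj₁ (hi j)) ∷ w∈C (inj₂ (suc j)) ∷ [])

        ¬B≺C : ¬ B ≺ C
        ¬B≺C lt = ℕ.<-irrefl refl (begin-strict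
          b * ∣ B ∣ + a * ∣R∣ S C
            <⟨ lt ⟩
          b * ∣ C ∣ + a * ∣R∣ S B
            ≡⟨ cong (λ n → b * n + a * ∣R∣ S B) (trans (length-++ (elems B)) (cong (∣ B ∣ +_) (length-map E new))) ⟩
          b * (∣ B ∣ + length new) + a * ∣R∣ S B
            ≡⟨ cong (_+ a * ∣R∣ S B) (trans (ℕ.*-distribˡ-+ b ∣ B ∣ _) (cong (λ n → b * ∣ B ∣ + n) (ℕ.*-comm b _))) ⟩
          b * ∣ B ∣ + length new * b + a * ∣R∣ S B
            ≤⟨ ℕ.+-monoˡ-≤ (a * ∣R∣ S B) (ℕ.+-monoʳ-≤ (b * ∣ B ∣) cells) ⟩
          b * ∣ B ∣ + length meeting * a + a * ∣R∣ S B
            ≡⟨ trans (ℕ.+-assoc (b * ∣ B ∣) _ _) (cong (λ n → b * ∣ B ∣ + (n + a * ∣R∣ S B)) (ℕ.*-comm (length meeting) a)) ⟩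
          b * ∣ B ∣ + (a * length meeting + a * ∣R∣ S B)
            ≡⟨ cong (λ n → b * ∣ B ∣ + n) (ℕ.*-distribˡ-+ a (length meeting) _) ⟨
          b * ∣ B ∣ + a * (length meeting + ∣R∣ S B)
            ≤⟨ ℕ.+-monoʳ-≤ (b * ∣ B ∣) (ℕ.*-monoʳ-≤ a ∣R∣-C) ⟩
          b * ∣ B ∣ + a * ∣R∣ S C ∎)
          where open ℕ.≤-Reasoning

      -- Adding the missing gadget points to `B` does not raise the weight, while strength demands a
      -- strict increase as soon as one point is missing.
      gad-closed : StrongIn α S B → ∀ i → E i ∈ elems B
      gad-closed sB i = [ (λ Ei∈B → Ei∈B) , (λ Ei∉B → ⊥-elim (¬B≺C
          (strong⁻ {B} {C} {C} (sB C ∈-++⁺ˡ) (∈-++⁺ˡ , λ C⊆B → Ei∉B (C⊆B (w∈C (inj₁ i)))) (λ x∈ → x∈)))) ]′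
        (toSum (E i ∈? elems B))

-- Extending a strong set by gadgets

T-does : ∀ {P : Set} (P? : Dec P) → T (does P?) → P
T-does (true because ofʸ p) _ = p

does-T : ∀ {P : Set} (P? : Dec P) → P → T (does P?)
does-T P? p = subst T (sym (dec-true P? p)) _

mapᵗ : ∀ {X Y : Set} → (X → Y) → Triple X → Triple Y
mapᵗ f (x , y , z) = f x , f y , f z

⊑-map : ∀ {X Y : Set} (f : X → Y) {t u} → t ⊑ u → mapᵗ f t ⊑ mapᵗ f u
⊑-map f (x∈ ∷ y∈ ∷ z∈ ∷ []) = ∈-map⁺ f x∈ ∷ ∈-map⁺ f y∈ ∷ ∈-map⁺ f z∈ ∷ []

≈-map : ∀ {X Y : Set} (f : X → Y) {t u} → t ≈ u → mapᵗ f t ≈ mapᵗ f u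
≈-map f {t} {u} (p , q) = ⊑-map f {t} {u} p , ⊑-map f {u} {t} q

module _ {X Y : Set} {S : Str X} {S′ : Str Y} (f : S ↪ S′) where

  mapˢ : FinSubset X → FinSubset Y
  mapˢ A = ⟨ map (to f) (elems A) , Unique.map⁺ (injective f) (unique A) ⟩

  pairs-map : ∀ xs → pairs (map (to f) xs) ≡ map (λ (x , y) → to f x , to f y) (pairs xs)
  pairs-map []       = refl
  pairs-map (x ∷ xs) = trans
    (cong₂ _++_ (trans (sym (map-∘ xs)) (map-∘ xs)) (pairs-map xs))
    (sym (map-++ _ (map (x ,_) xs) (pairs xs)))

  triples-map : ∀ xs → triples (map (to f) xs) ≡ map (mapᵗ (to f)) (triples xs)
  triples-map []       = refl
  triples-map (x ∷ xs) = trans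
    (cong₂ _++_
      (trans (cong (map (to f x ,_)) (pairs-map xs)) (trans (sym (map-∘ (pairs xs))) (map-∘ (pairs xs))))
      (triples-map xs))
    (sym (map-++ _ (map (x ,_) (pairs xs)) (triples xs)))

  ∣R∣-map : ∀ A → ∣R∣ S′ (mapˢ A) ≡ ∣R∣ S A
  ∣R∣-map A = trans (cong (length ∘ filter (λ (x , y , z) → T? (R S′ x y z))) (triples-map (elems A)))
                    (go (triples (elems A)))
    where
    go : ∀ ts → length (filter (λ (x , y , z) → T? (R S′ x y z)) (map (mapᵗ (to f)) ts))
              ≡ length (filter (λ (x , y , z) → T? (R S x y z)) ts)
    go []                 = refl
    go ((x , y , z) ∷ ts) rewrite R-iff f x y z with R S x y z
    ... | true  = cong suc (go ts)
    ... | false = go ts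

  ∣∣-map : ∀ A → ∣ mapˢ A ∣ ≡ ∣ A ∣
  ∣∣-map A = length-map (to f) (elems A)

module Extend (a′ b′ : ℕ) (a≤b : suc a′ ℕ.≤ suc b′) {m k : ℕ} (S₀ : Str (Fin m)) (s : Fin k → Fin m) where

  open Gadget a′ b′ a≤b

  -- The extension of S₀ by the new base par, the gadgets pt false i over par, and
  -- the gadgets pt true i over (pt false i 0 , s i , par 2 , par 3 , …).
  data V : Set where
    old : Fin m → V
    par : Fin (suc b) → V
    pt  : Bool → Fin k → Fin a → V

  n = m + (suc b + 2 * (k * a))

  enc↔ : V ↔ Fin n
  enc↔ = (↔-sym (Fin.+↔⊎ {m}) ↔-∘ (↔-id _ ⊎-↔ (↔-sym (Fin.+↔⊎ {suc b}) ↔-∘ (↔-id _ ⊎-↔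
           (↔-sym (Fin.*↔× {2}) ↔-∘ (↔-sym Fin.2↔Bool ×-↔ ↔-sym (Fin.*↔× {k}))))))) ↔-∘ V↔⊎
    where
    V↔⊎ : V ↔ (Fin m ⊎ Fin (suc b) ⊎ Bool × Fin k × Fin a)
    V↔⊎ = mk↔ₛ′ (λ { (old x) → inj₁ x ; (par p) → inj₂ (inj₁ p) ; (pt g i x) → inj₂ (inj₂ (g , i , x)) })
      (λ { (inj₁ x) → old x ; (inj₂ (inj₁ p)) → par p ; (inj₂ (inj₂ (g , i , x))) → pt g i x })
      (λ { (inj₁ x) → refl ; (inj₂ (inj₁ p)) → refl ; (inj₂ (inj₂ (g , i , x))) → refl })
      (λ { (old x) → refl ; (par p) → refl ; (pt g i x) → refl })

  abstract
    _≟_ : DecidableEquality V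
    _≟_ = Fin.inj⇒≟ (↔⇒↣ enc↔)

  open DecMembership _≟_ using (_∈?_)

  base : Bool → Fin k → Fin (suc b) → V
  base false i p             = par p
  base true  i zero          = pt false i zero
  base true  i (suc zero)    = old (s i)
  base true  i (suc (suc p)) = par (suc (suc p))

  w : Bool → Fin k → Slot → V
  w g i = [ pt g i , base g i ]′

  w-injective : ∀ g i → Injective _≡_ _≡_ (w g i)
  w-injective g     i {inj₁ x}                {inj₁ .x}                refl = refl
  w-injective false i {inj₂ p}                {inj₂ .p}                refl = refl
  w-injective true  i {inj₂ zero}             {inj₂ zero}              refl = refl
  w-injective true  i {inj₂ (suc zero)}       {inj₂ (suc zero)}        refl = refl
  w-injective true  i {inj₂ (suc (suc p))}    {inj₂ (suc (suc .p))}    refl = refl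
  w-injective true  i {inj₂ zero}             {inj₂ (suc zero)}        ()
  w-injective true  i {inj₂ zero}             {inj₂ (suc (suc _))}     ()
  w-injective true  i {inj₁ x}                {inj₂ zero}              ()
  w-injective true  i {inj₁ x}                {inj₂ (suc zero)}        ()
  w-injective true  i {inj₁ x}                {inj₂ (suc (suc _))}     ()
  w-injective true  i {inj₂ zero}             {inj₁ x}                 ()
  w-injective true  i {inj₂ (suc zero)}       {inj₁ x}                 ()
  w-injective true  i {inj₂ (suc (suc _))}    {inj₁ x}                 ()

  Index : Set
  Index = Bool × Fin k × Fin b

  end : Index → Triple V
  end (g , i , j) = edge (w g i) j

  indices : List Index
  indices = cartesianProduct (false ∷ true ∷ []) (cartesianProduct (allFin k) (allFin b))

  ∈-indices : ∀ e → e ∈ indices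
  ∈-indices (g , i , j) = ∈-cartesianProduct⁺ (∈-Bool g) (∈-cartesianProduct⁺ (∈-allFin i) (∈-allFin j))
    where
    ∈-Bool : ∀ g → g ∈ false ∷ true ∷ []
    ∈-Bool false = here refl
    ∈-Bool true  = there (here refl)

  indices-unique : Unique indices
  indices-unique = Unique.cartesianProduct⁺ (((λ ()) ∷ []) ∷ [] ∷ [])
    (Unique.cartesianProduct⁺ (Unique.allFin⁺ k) (Unique.allFin⁺ b))

  data OldEdge : Triple V → Set where
    oldEdge : ∀ {x y z} → T (R S₀ x y z) → OldEdge (old x , old y , old z)

  Distinct : Triple V → Set
  Distinct (x , y , z) = x ≢ y × y ≢ z × x ≢ z

  NewEdge : Triple V → Set
  NewEdge t = Distinct t × Any (λ e → t ≈ end e) indices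

  Edge : Triple V → Set
  Edge t = OldEdge t ⊎ NewEdge t

  old? : Decidable OldEdge
  old? (old x , old y , old z) = map′ oldEdge (λ { (oldEdge r) → r }) (T? (R S₀ x y z))
  old? (par _ , _ , _)             = no λ ()
  old? (pt _ _ _ , _ , _)          = no λ ()
  old? (old _ , par _ , _)         = no λ ()
  old? (old _ , pt _ _ _ , _)      = no λ ()
  old? (old _ , old _ , par _)     = no λ ()
  old? (old _ , old _ , pt _ _ _)  = no λ ()

  new? : Decidable NewEdge
  new? t@(x , y , z) = (¬? (x ≟ y) ×-dec ¬? (y ≟ z) ×-dec ¬? (x ≟ z))
    ×-dec any? (λ e → all? (_∈? toList (end e)) (toList t) ×-dec all? (_∈? toList t) (toList (end e))) indices

  abstract
    edge? : Decidable Edge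
    edge? t = old? t ⊎-dec new? t

  Edge-swap₁₂ : ∀ {x y z} → Edge (x , y , z) → Edge (y , x , z)
  Edge-swap₁₂ (inj₁ (oldEdge r)) = inj₁ (oldEdge (R₁₂ S₀ r))
  Edge-swap₁₂ (inj₂ ((x≢y , y≢z , x≢z) , t∈)) = inj₂ ((x≢y ∘ sym , x≢z , y≢z) , Any.map (≈-trans ≈-swap₁₂) t∈)

  Edge-swap₂₃ : ∀ {x y z} → Edge (x , y , z) → Edge (x , z , y)
  Edge-swap₂₃ (inj₁ (oldEdge r)) = inj₁ (oldEdge (R₂₃ S₀ r))
  Edge-swap₂₃ (inj₂ ((x≢y , y≢z , x≢z) , t∈)) = inj₂ ((x≢z , y≢z ∘ sym , x≢y) , Any.map (≈-trans ≈-swap₂₃) t∈)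

  old-injective : ∀ {x y} → old x ≡ old y → x ≡ y
  old-injective refl = refl

  Edge-distinct : ∀ {t} → Edge t → Distinct t
  Edge-distinct (inj₂ (d , _)) = d
  Edge-distinct (inj₁ (oldEdge r)) with R-distinct S₀ r
  ... | x≢y , y≢z , x≢z = x≢y ∘ old-injective , y≢z ∘ old-injective , x≢z ∘ old-injective

  SV : Str V
  SV .R x y z          = does (edge? (x , y , z))
  SV .R-swap₁₂ x y z   = does-⇔ (mk⇔ Edge-swap₁₂ Edge-swap₁₂) (edge? (x , y , z)) (edge? (y , x , z))
  SV .R-swap₂₃ x y z   = does-⇔ (mk⇔ Edge-swap₂₃ Edge-swap₂₃) (edge? (x , y , z)) (edge? (x , z , y))
  SV .R-distinct {x} {y} {z} r = Edge-distinct (T-does (edge? (x , y , z)) r)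

  -- Each new edge has a gadget point as its `hi` vertex. Hence the old points carry no additional
  -- edges, and `S₀` is an induced substructure.
  ¬NewEdge-old : ∀ {x y z} → ¬ NewEdge (old x , old y , old z)
  ¬NewEdge-old (_ , t∈) with find t∈
  ... | (g , i , j) , _ , (_ , _ ∷ hi∈ ∷ _) = go hi∈
    where
    go : ∀ {x y z} → ¬ pt g i (hi j) ∈ old x ∷ old y ∷ old z ∷ []
    go (there (there (there ())))

  inclusion : S₀ ↪ SV
  inclusion .to          = old
  inclusion .injective   = old-injective
  inclusion .R-iff x y z = does-⇔
    (mk⇔ (λ { (inj₁ (oldEdge r)) → r ; (inj₂ n) → ⊥-elim (¬NewEdge-old n) }) (inj₁ ∘ oldEdge))
    (edge? (old x , old y , old z)) (T? (R S₀ x y z))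

  gadget : ∀ g i → Gad SV (base g i) (pt g i)
  gadget g i = w-injective g i , λ j → does-T (edge? (edge (w g i) j)) (inj₂
    ( ((λ eq → lo≢hi j (w-injective g i eq))
      , (λ eq → inj₁≢inj₂ (w-injective g i {inj₁ (hi j)} {inj₂ (suc j)} eq))
      , (λ eq → lo≢suc j (w-injective g i eq)))
    , lose (∈-indices (g , i , j)) ≈-refl))
    where
    inj₁≢inj₂ : ∀ {A B : Set} {x : A} {y : B} → inj₁ x ≢ inj₂ y
    inj₁≢inj₂ ()

  -- Weights of subsets of the extension.

  module Count (C : FinSubset V) where

    O : FinSubset (Fin m)
    O = ⟨ filter (λ x → old x ∈? elems C) (allFin m)
        , Unique.filter⁺ (λ x → old x ∈? elems C) (Unique.allFin⁺ m) ⟩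

    ∈-O⁺ : ∀ {x} → old x ∈ elems C → x ∈ elems O
    ∈-O⁺ x∈ = ∈-filter⁺ (λ x → old x ∈? elems C) (∈-allFin _) x∈

    ∈-O⁻ : ∀ {x} → x ∈ elems O → old x ∈ elems C
    ∈-O⁻ x∈ = proj₂ (∈-filter⁻ (λ x → old x ∈? elems C) {xs = allFin m} x∈)

    inside? : Decidable (λ e → All (_∈ elems C) (toList (end e)))
    inside? e = all? (_∈? elems C) (toList (end e))

    Es : List Index
    Es = filter inside? indices

    Es⁻ : ∀ {e} → e ∈ Es → All (_∈ elems C) (toList (end e))
    Es⁻ e∈ = proj₂ (∈-filter⁻ inside? {xs = indices} e∈)

    -- An upper bound suffices for estimating weights from below, so it does no harm if two indices
    -- were to give the same edge.
    ∣R∣-C : ∣R∣ SV C ℕ.≤ ∣R∣ S₀ O + length Es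
    ∣R∣-C = subst (∣R∣ SV C ℕ.≤_)
      (trans (length-++ (map (mapᵗ old) (edges S₀ O))) (cong₂ _+_ (length-map _ (edges S₀ O)) (length-map end Es)))
      (∣R∣-≤ SV {us = map (mapᵗ old) (edges S₀ O) ++ map end Es} C λ {t} e t⊆C → go (T-does (edge? t) e) t⊆C)
      where
      go : ∀ {t} → Edge t → All (_∈ elems C) (toList t) → Any (t ≈_) (map (mapᵗ old) (edges S₀ O) ++ map end Es)
      go (inj₁ (oldEdge r)) t⊆C = Any.++⁺ˡ (Any.map⁺ (Any.map (λ {u} → ≈-map old {_} {u})
        (edges⁺ S₀ O r (All.map ∈-O⁺ (All.map⁻ t⊆C)))))
      go (inj₂ (_ , t∈)) t⊆C with find t∈
      ... | e , e∈ , t≈ =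
        Any.++⁺ʳ _ (Any.map⁺ (lose (∈-filter⁺ inside? e∈ (All.map (All.lookup t⊆C) (proj₂ t≈))) t≈))

    -- Each new edge charges its `a` cells to the gadget points that own them, and each vertex has
    -- `b` cells to be charged.
    cell : Index × Fin a → V × Fin b
    cell ((g , i , j) , κ) = pt g i (proj₁ (recut (j , κ))) , proj₂ (recut (j , κ))

    cell-injective : Injective _≡_ _≡_ cell
    cell-injective {(g , i , j) , κ} {(g′ , i′ , j′) , κ′} eq = go refl refl eq
      where
      go : ∀ {x x′} → recut (j , κ) ≡ x → recut (j′ , κ′) ≡ x′ →
           (pt g i (proj₁ x) , proj₂ x) ≡ (pt g′ i′ (proj₁ x′) , proj₂ x′) → ((g , i , j) , κ) ≡ ((g′ , i′ , j′) , κ′)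
      go p q refl with recut-injective {x = j , κ} {j′ , κ′} (trans p (sym q))
      ... | refl = refl

    cell-∈C : ∀ {e} κ → e ∈ Es → proj₁ (cell (e , κ)) ∈ elems C
    cell-∈C {g , i , j} κ e∈ with Es⁻ e∈ | cell-∈ j κ
    ... | lo∈ ∷ _       | inj₁ eq = subst (λ σ → w g i σ ∈ elems C) (sym eq) lo∈
    ... | _ ∷ hi∈ ∷ _   | inj₂ eq = subst (λ x → pt g i x ∈ elems C) (sym eq) hi∈

    IsOld : V → Set
    IsOld v = ∃[ x ] v ≡ old x

    Free : V → Set
    Free v = ∀ {g i j x} → (g , i , j) ∈ Es → v ≢ pt g i x

    -- A free vertex is charged by no edge inside C, so its b cells are spare.
    count : ∀ vs → Unique vs → All (λ v → v ∈ elems C × ¬ IsOld v × Free v) vs →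
            ∣ O ∣ * b + length Es * a + length vs ℕ.≤ ∣ C ∣ * b
    count vs vs! vs∈ = subst₂ ℕ._≤_ lhs (length-×-allFin (elems C) b)
      (length-≤ (λ x → x) (λ eq → eq)
        (Unique.++⁺ (Unique.++⁺
          (Unique.map⁺ (λ { refl → refl }) (Unique.cartesianProduct⁺ (unique O) (Unique.allFin⁺ b)))
          (Unique.map⁺ cell-injective
            (Unique.cartesianProduct⁺ (Unique.filter⁺ inside? indices-unique) (Unique.allFin⁺ a)))
          old#new)
          (Unique.map⁺ (λ { refl → refl }) vs!)
          cells#vs)
        ⊆C)
      where
      olds  = map (λ (x , l) → old x , l) (cartesianProduct (elems O) (allFin b))
      news  = map cell (cartesianProduct Es (allFin a))
      -- One uncharged cell for each free vertex is enough for a strict inequality.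
      frees = map (λ v → v , zero {b′}) vs

      lhs : length ((olds ++ news) ++ frees) ≡ ∣ O ∣ * b + length Es * a + length vs
      lhs = trans (length-++ (olds ++ news)) (cong₂ _+_ (trans (length-++ olds) (cong₂ _+_
        (trans (length-map _ (cartesianProduct (elems O) (allFin b))) (length-×-allFin (elems O) b))
        (trans (length-map cell (cartesianProduct Es (allFin a))) (length-×-allFin Es a))))
        (length-map _ vs))

      old#new : ∀ {v} → ¬ (v ∈ olds × v ∈ news)
      old#new (v∈o , v∈n) with ∈-map⁻ _ v∈o | ∈-map⁻ cell v∈n
      ... | _ , _ , refl | _ , _ , ()

      cells#vs : ∀ {v} → ¬ (v ∈ olds ++ news × v ∈ frees)
      cells#vs (v∈ , v∈f) with ∈-map⁻ _ v∈f
      ... | v , v∈vs , refl with All.lookup vs∈ v∈vs | ∈-++⁻ olds v∈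
      ...   | _ , ¬old , free | inj₁ v∈o with ∈-map⁻ _ v∈o
      ...     | (x , _) , _ , refl = ¬old (x , refl)
      cells#vs (v∈ , v∈f) | v , v∈vs , refl | _ , ¬old , free | inj₂ v∈n with ∈-map⁻ cell v∈n
      ...     | (e , κ) , eκ∈ , eq = free (proj₁ (∈-cartesianProduct⁻ Es (allFin a) eκ∈)) (,-injectiveˡ eq)

      ⊆C : ∀ {v} → v ∈ (olds ++ news) ++ frees → v ∈ cartesianProduct (elems C) (allFin b)
      ⊆C v∈ with ∈-++⁻ (olds ++ news) v∈
      ... | inj₂ v∈f with ∈-map⁻ _ v∈f
      ...   | v , v∈vs , refl = ∈-cartesianProduct⁺ (proj₁ (All.lookup vs∈ v∈vs)) (∈-allFin _)
      ⊆C v∈ | inj₁ v∈′ with ∈-++⁻ olds v∈′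
      ... | inj₁ v∈o with ∈-map⁻ _ v∈o
      ...   | (x , _) , xl∈ , refl =
        ∈-cartesianProduct⁺ (∈-O⁻ (proj₁ (∈-cartesianProduct⁻ (elems O) (allFin b) xl∈))) (∈-allFin _)
      ⊆C v∈ | inj₁ v∈′ | inj₂ v∈n with ∈-map⁻ cell v∈n
      ...   | (e , κ) , eκ∈ , refl =
        ∈-cartesianProduct⁺ (cell-∈C κ (proj₁ (∈-cartesianProduct⁻ Es (allFin a) eκ∈))) (∈-allFin _)

    weigh : ∀ d → ∣ O ∣ * b + length Es * a + d ℕ.≤ ∣ C ∣ * b →
            b * ∣ O ∣ + a * ∣R∣ SV C + d ℕ.≤ b * ∣ C ∣ + a * ∣R∣ S₀ O
    weigh d le = begin
      b * ∣ O ∣ + a * ∣R∣ SV C + d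
        ≤⟨ ℕ.+-monoˡ-≤ d (ℕ.+-monoʳ-≤ (b * ∣ O ∣) (ℕ.*-monoʳ-≤ a ∣R∣-C)) ⟩
      b * ∣ O ∣ + a * (∣R∣ S₀ O + length Es) + d
        ≡⟨ cong (_+ d) (cong₂ _+_ (ℕ.*-comm b ∣ O ∣) (trans (ℕ.*-distribˡ-+ a (∣R∣ S₀ O) _)
             (trans (ℕ.+-comm (a * ∣R∣ S₀ O) (a * length Es)) (cong (_+ a * ∣R∣ S₀ O) (ℕ.*-comm a (length Es)))))) ⟩
      ∣ O ∣ * b + (length Es * a + a * ∣R∣ S₀ O) + d
        ≡⟨ cong (_+ d) (sym (ℕ.+-assoc (∣ O ∣ * b) (length Es * a) (a * ∣R∣ S₀ O))) ⟩
      ∣ O ∣ * b + length Es * a + a * ∣R∣ S₀ O + d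
        ≡⟨ xy∙z≈xz∙y ℕ.+-commutativeSemigroup (∣ O ∣ * b + length Es * a) (a * ∣R∣ S₀ O) d ⟩
      ∣ O ∣ * b + length Es * a + d + a * ∣R∣ S₀ O
        ≤⟨ ℕ.+-monoˡ-≤ _ le ⟩
      ∣ C ∣ * b + a * ∣R∣ S₀ O
        ≡⟨ cong (_+ a * ∣R∣ S₀ O) (ℕ.*-comm ∣ C ∣ b) ⟩
      b * ∣ C ∣ + a * ∣R∣ S₀ O ∎
      where open ℕ.≤-Reasoning

    weight-≤ : b * ∣ O ∣ + a * ∣R∣ SV C ℕ.≤ b * ∣ C ∣ + a * ∣R∣ S₀ O
    weight-≤ = subst (ℕ._≤ b * ∣ C ∣ + a * ∣R∣ S₀ O) (ℕ.+-identityʳ _) (weigh 0 (count [] [] []))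

    weight-<′ : ∀ {v} → v ∈ elems C → ¬ IsOld v → Free v → b * ∣ O ∣ + a * ∣R∣ SV C ℕ.< b * ∣ C ∣ + a * ∣R∣ S₀ O
    weight-<′ {v} v∈ ¬old free = subst (ℕ._≤ b * ∣ C ∣ + a * ∣R∣ S₀ O) (ℕ.+-comm _ 1)
      (weigh 1 (count (v ∷ []) ([] ∷ []) ((v∈ , ¬old , free) ∷ [])))

    IsPar IsLow : V → Set
    IsPar v = ∃[ p ] v ≡ par p
    IsLow v = ∃[ i ] ∃[ x ] v ≡ pt false i x

    isPar? : Decidable IsPar
    isPar? (old x)    = no λ ()
    isPar? (par p)    = yes (p , refl)
    isPar? (pt g i x) = no λ ()

    isLow? : Decidable IsLow
    isLow? (old x)        = no λ ()
    isLow? (par p)        = no λ ()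
    isLow? (pt false i x) = yes (i , x , refl)
    isLow? (pt true i x)  = no λ ()

    -- In the order par, pt false, pt true, every new edge contains a vertex of
    -- an earlier kind than its gadget points.  Hence no edge inside C charges a
    -- vertex of the earliest kind present in C.
    weight-< : ∀ {v} → v ∈ elems C → ¬ IsOld v → b * ∣ O ∣ + a * ∣R∣ SV C ℕ.< b * ∣ C ∣ + a * ∣R∣ S₀ O
    weight-< {v} v∈ ¬old = go (toSum (any? isPar? (elems C))) (toSum (any? isLow? (elems C)))
      where
      par∉ : ¬ Any IsPar (elems C) → ∀ {p} → par p ∉ elems C
      par∉ ¬par p∈ = ¬par (lose p∈ (_ , refl))

      no-low : ¬ Any IsPar (elems C) → ∀ {i j} → (false , i , j) ∉ Es
      no-low ¬par e∈ with Es⁻ e∈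
      ... | _ ∷ _ ∷ q∈ ∷ [] = par∉ ¬par q∈

      no-high : ¬ Any IsPar (elems C) → ¬ Any IsLow (elems C) →
                ∀ {i j} → (true , i , j) ∉ Es
      no-high ¬par ¬low {i} {suc j} e∈ with Es⁻ e∈
      ... | _ ∷ _ ∷ q∈ ∷ [] = par∉ ¬par q∈
      -- The first edge of a link gadget ends in `old (s i)` instead of a `par` vertex; its `lo`
      -- vertex `pt false i zero` is the one of an earlier kind.
      no-high ¬par ¬low {i} {zero} e∈ with Es⁻ e∈
      ... | lo∈ ∷ _ = ¬low (lose (subst (λ σ → w true i σ ∈ elems C) lo-zero lo∈) (_ , _ , refl))

      go : Any IsPar (elems C) ⊎ ¬ Any IsPar (elems C) →
           Any IsLow (elems C) ⊎ ¬ Any IsLow (elems C) →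
           b * ∣ O ∣ + a * ∣R∣ SV C ℕ.< b * ∣ C ∣ + a * ∣R∣ S₀ O
      go (inj₁ ∃par) _ with find ∃par
      ... | _ , p∈ , (p , refl) = weight-<′ p∈ (λ ()) (λ _ ())
      go (inj₂ ¬par) (inj₁ ∃low) with find ∃low
      ... | _ , v∈ , (i , x , refl) = weight-<′ v∈ (λ ()) (λ { {false} e∈ _ → no-low ¬par e∈ ; {true} _ () })
      go (inj₂ ¬par) (inj₂ ¬low) = weight-<′ v∈ ¬old
        (λ { {false} e∈ _ → no-low ¬par e∈ ; {true} e∈ _ → no-high ¬par ¬low e∈ })

infixr 9 _∘↪_
_∘↪_ : ∀ {X Y Z} {S : Str X} {S′ : Str Y} {S″ : Str Z} → S′ ↪ S″ → S ↪ S′ → S ↪ S″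
(g ∘↪ f) .to            = to g ∘ to f
(g ∘↪ f) .injective     = injective f ∘ injective g
(g ∘↪ f) .R-iff x y z   = trans (R-iff g _ _ _) (R-iff f x y z)

-- The extension lies in the class and is strong over the old points.

module Amalgam (α : ℚ) (a′ b′ : ℕ) (α≃a/b : ℚ.toℚᵘ α ≃ᵘ mkℚᵘ (ℤ.+ suc a′) b′) (a≤b : suc a′ ℕ.≤ suc b′)
               {m k : ℕ} (S₀ : Str (Fin m)) (s : Fin k → Fin m)
               (positive : ∀ O → ∃[ x ] x ∈ elems O → suc a′ * ∣R∣ S₀ O ℕ.< suc b′ * ∣ O ∣) where

  open Gadget a′ b′ a≤b
  open Extend a′ b′ a≤b S₀ s

  open Inverse enc↔ public using ()
    renaming (to to enc; from to dec; strictlyInverseˡ to enc∘dec; strictlyInverseʳ to dec∘enc)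

  dec-injective : Injective _≡_ _≡_ dec
  dec-injective {x} {y} eq = trans (sym (enc∘dec x)) (trans (cong enc eq) (enc∘dec y))

  enc-injective : Injective _≡_ _≡_ enc
  enc-injective {x} {y} eq = trans (sym (dec∘enc x)) (trans (cong dec eq) (dec∘enc y))

  B : Str (Fin n)
  B .R x y z        = R SV (dec x) (dec y) (dec z)
  B .R-swap₁₂ x y z = R-swap₁₂ SV (dec x) (dec y) (dec z)
  B .R-swap₂₃ x y z = R-swap₂₃ SV (dec x) (dec y) (dec z)
  B .R-distinct r   = let x≢y , y≢z , x≢z = R-distinct SV r in x≢y ∘ cong dec , y≢z ∘ cong dec , x≢z ∘ cong dec

  decode : B ↪ SV
  decode .to        = dec
  decode .injective = dec-injective
  decode .R-iff _ _ _ = refl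

  encode : SV ↪ B
  encode .to        = enc
  encode .injective = enc-injective
  encode .R-iff x y z rewrite dec∘enc x | dec∘enc y | dec∘enc z = refl

  f : S₀ ↪ B
  f .to        = enc ∘ old
  f .injective = old-injective ∘ enc-injective
  f .R-iff x y z = trans (R-iff encode (old x) (old y) (old z)) (R-iff inclusion x y z)

  positive-≤ : ∀ O → a * ∣R∣ S₀ O ℕ.≤ b * ∣ O ∣
  positive-≤ ⟨ []     , _ ⟩ = ℕ.≤-reflexive (trans (ℕ.*-zeroʳ a) (sym (ℕ.*-zeroʳ b)))
  positive-≤ O@(⟨ x ∷ _ , _ ⟩) = ℕ.<⇒≤ (positive O (x , here refl))

  module _ (C : FinSubset (Fin n)) where
    private
      D = mapˢ decode C
    open Count D

    isOld? : Decidable IsOld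
    isOld? (old x)    = yes (x , refl)
    isOld? (par p)    = no λ ()
    isOld? (pt g i x) = no λ ()

    all-old? : (∃[ v ] v ∈ elems D × ¬ IsOld v) ⊎ (∀ {x} → x ∈ elems C → ∃[ y ] dec x ≡ old y × y ∈ elems O)
    all-old? with any? (¬? ∘ isOld?) (elems D)
    ... | yes p = inj₁ (find p)
    ... | no ¬p = inj₂ λ {x} x∈ → go x x∈ (isOld? (dec x))
      where
      go : ∀ x → x ∈ elems C → Dec (IsOld (dec x)) → ∃[ y ] dec x ≡ old y × y ∈ elems O
      go x x∈ (no ¬old)        = ⊥-elim (¬p (lose (∈-map⁺ dec x∈) ¬old))
      go x x∈ (yes (y , eq)) = y , eq , ∈-O⁺ (subst (_∈ elems D) eq (∈-map⁺ dec x∈))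

    -- The weight of `C` is that of its old part plus a gain. Neither is negative; the gain is
    -- positive if `C` has a new vertex, and otherwise the old part is nonempty and has positive
    -- weight.
    B-positive : ∀ {x} → x ∈ elems C → a * ∣R∣ B C ℕ.< b * ∣ C ∣
    B-positive {x} x∈ = subst₂ ℕ._<_ (cong (a *_) (∣R∣-map decode C)) (cong (b *_) (∣∣-map decode C))
      ([ (λ (v , v∈ , ¬old) → ℕ.+-cancelˡ-< (b * ∣ O ∣) _ _ (begin-strict
           b * ∣ O ∣ + a * ∣R∣ SV D  <⟨ weight-< v∈ ¬old ⟩
           b * ∣ D ∣ + a * ∣R∣ S₀ O  ≤⟨ ℕ.+-monoʳ-≤ (b * ∣ D ∣) (positive-≤ O) ⟩
           b * ∣ D ∣ + b * ∣ O ∣     ≡⟨ ℕ.+-comm (b * ∣ D ∣) _ ⟩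
           b * ∣ O ∣ + b * ∣ D ∣     ∎))
       , (λ C-old → ℕ.+-cancelˡ-< (b * ∣ O ∣) _ _ (begin-strict
           b * ∣ O ∣ + a * ∣R∣ SV D  ≤⟨ weight-≤ ⟩
           b * ∣ D ∣ + a * ∣R∣ S₀ O  <⟨ ℕ.+-monoʳ-< (b * ∣ D ∣) (positive O (map₂ proj₂ (C-old x∈))) ⟩
           b * ∣ D ∣ + b * ∣ O ∣     ≡⟨ ℕ.+-comm (b * ∣ D ∣) _ ⟩
           b * ∣ O ∣ + b * ∣ D ∣     ∎))
       ]′ all-old?)
      where open ℕ.≤-Reasoning

    -- Here the old part of `C` is everything, and a proper superset of the image must contain a new
    -- vertex, which makes the gain strict.
    image-≺ : image f ⊊ C → b * ∣ image f ∣ + a * ∣R∣ B C ℕ.< b * ∣ C ∣ + a * ∣R∣ B (image f)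
    image-≺ (f⊆C , C⊈f) = subst₂ ℕ._<_
      (cong₂ _+_ (cong (b *_) (sym (∣∣-map f (universe m)))) (cong (a *_) (∣R∣-map decode C)))
      (cong₂ _+_ (cong (b *_) (∣∣-map decode C)) (cong (a *_) (sym (∣R∣-map f (universe m)))))
      ([ (λ (v , v∈ , ¬old) → begin-strict
           b * ∣ universe m ∣ + a * ∣R∣ SV D
             ≤⟨ ℕ.+-monoˡ-≤ (a * ∣R∣ SV D) (ℕ.*-monoʳ-≤ b (∣∣-mono {A = universe m} {O} univ⊆O)) ⟩
           b * ∣ O ∣ + a * ∣R∣ SV D
             <⟨ weight-< v∈ ¬old ⟩
           b * ∣ D ∣ + a * ∣R∣ S₀ O
             ≤⟨ ℕ.+-monoʳ-≤ (b * ∣ D ∣) (ℕ.*-monoʳ-≤ a (∣R∣-mono S₀ {O} {universe m} (λ _ → ∈-allFin _))) ⟩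
           b * ∣ D ∣ + a * ∣R∣ S₀ (universe m) ∎)
       , (λ C-old → ⊥-elim (C⊈f (λ x∈ → ⊆image (C-old x∈))))
       ]′ all-old?)
      where
      open ℕ.≤-Reasoning
      ⊆image : ∀ {x} → ∃[ y ] dec x ≡ old y × y ∈ elems O → x ∈ elems (image f)
      ⊆image {x} (y , eq , _) = subst (_∈ elems (image f))
        (trans (cong enc (sym eq)) (enc∘dec x)) (∈-map⁺ (enc ∘ old) (∈-allFin y))
      univ⊆O : universe m ⊆ O
      univ⊆O {x} _ = ∈-O⁺ (subst (_∈ elems D) (dec∘enc (old x)) (∈-map⁺ dec (f⊆C (∈-map⁺ (enc ∘ old) (∈-allFin x)))))

  private
    module W = Weighted α a b′ α≃a/b Fin._≟_ B

  B-inClass : InClass α B (universe n)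
  B-inClass = W.strong⁺ {∅} {universe n} (λ ()) λ C (_ , C⊈∅) _ → nonempty C C⊈∅
    where
    nonempty : ∀ C → ¬ C ⊆ ∅ → W._≺_ ∅ C
    nonempty ⟨ []    , _ ⟩ C⊈∅ = ⊥-elim (C⊈∅ λ ())
    nonempty C@(⟨ _ ∷ _ , _ ⟩) _ = subst₂ ℕ._<_ (cong (_+ a * ∣R∣ B C) (sym (ℕ.*-zeroʳ b)))
      (trans (sym (ℕ.+-identityʳ _)) (cong (λ z → b * ∣ C ∣ + z) (sym (ℕ.*-zeroʳ a)))) (B-positive C (here refl))

  f-strong : Strong α B (image f) (universe n)
  f-strong = W.strong⁺ {image f} {universe n} (λ _ → ∈-allFin _) λ C f⊊C _ → image-≺ C f⊊C

-- The copy of the extension inside the generic structure.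

module Realise (α : ℚ) (a′ b′ : ℕ) (α≃a/b : ℚ.toℚᵘ α ≃ᵘ mkℚᵘ (ℤ.+ suc a′) b′) (a≤b : suc a′ ℕ.≤ suc b′)
               {X : Set} (_≟_ : DecidableEquality X) (M : Str X) (generic : IsGeneric α M)
               (A : FinSubset X) (A-strong : StrongIn α M A) {k : ℕ} (s : Fin k → Fin ∣ A ∣) where

  open IsGeneric generic
  open Weighted α (suc a′) b′ α≃a/b _≟_ M using (strong⁻)
  open Extend a′ b′ a≤b (M ↾ A) s public

  ↾-inclusion : (M ↾ A) ↪ M
  ↾-inclusion .to          = elems A ‼_
  ↾-inclusion .injective   = lookup-injective (unique A)
  ↾-inclusion .R-iff _ _ _ = refl

  ↾-positive : ∀ O → ∃[ x ] x ∈ elems O → suc a′ * ∣R∣ (M ↾ A) O ℕ.< suc b′ * ∣ O ∣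
  ↾-positive O (x , x∈) = subst₂ ℕ._<_
    (trans (cong (_+ suc a′ * ∣R∣ M O′) (ℕ.*-zeroʳ (suc b′))) (cong (suc a′ *_) (∣R∣-map ↾-inclusion O)))
    (trans (cong (λ z → suc b′ * ∣ O′ ∣ + z) (ℕ.*-zeroʳ (suc a′)))
      (trans (ℕ.+-identityʳ _) (cong (suc b′ *_) (∣∣-map ↾-inclusion O))))
    (strong⁻ {∅} {O′} {O′} (inClass O′) ((λ ()) , λ O′⊆∅ → ∉[] (O′⊆∅ (∈-map⁺ (elems A ‼_) x∈))) (λ x∈ → x∈))
    where
    O′ = mapˢ ↾-inclusion O
    ∉[] : ∀ {x : X} → ¬ x ∈ []
    ∉[] ()

  private
    module Am = Amalgam α a′ b′ α≃a/b a≤b (M ↾ A) s ↾-positive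

    ext = extension A A-strong Am.B Am.B-inClass Am.f Am.f-strong
    g = proj₁ ext

  h : SV ↪ M
  h = g ∘↪ Am.encode

  h-old : ∀ x → to h (old x) ≡ elems A ‼ x
  h-old = proj₁ (proj₂ ext)

  -- Since `H` is strong and consists of images of `V`, `gad-closed` pulls the points of any gadget
  -- of `M` over points of `H` back to `V`, where the edges are known.
  strong-range : Σ[ H ∈ FinSubset X ] StrongIn α M H × (∀ v → to h v ∈ elems H) ×
                   (∀ {x} → x ∈ elems H → ∃[ v ] x ≡ to h v)
  strong-range = image g , proj₂ (proj₂ ext) , (λ v → ∈-map⁺ (to g) (∈-allFin (Am.enc v))) , λ x∈ →
    let i , _ , eq = ∈-map⁻ (to g) x∈ in Am.dec i , trans eq (cong (to g) (sym (Am.enc∘dec i)))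

-- The sentence

open Equivalence using () renaming (to to to⇔; from to from⇔)

∀ⁿ : ∀ k {n} → Formula (k + n) → Formula n
∀ⁿ zero    φ = φ
∀ⁿ (suc k) φ = ∀ⁿ k (∀′ φ)

Sat-∀ⁿ : ∀ k {n X} {S : Str X} {ρ : Vec X n} {φ : Formula (k + n)} →
         Sat S ρ (∀ⁿ k φ) ⇔ (∀ (v : Vec X k) → Sat S (v ⧺ ρ) φ)
Sat-∀ⁿ zero    = mk⇔ (λ { s [] → s }) (λ s → s [])
Sat-∀ⁿ (suc k) = mk⇔ (λ { s (x ∷ v) → to⇔ (Sat-∀ⁿ k) s v x }) (λ s → from⇔ (Sat-∀ⁿ k) λ v x → s (x ∷ v))

Sat-⇒* : ∀ {n X} {S : Str X} {ρ : Vec X n} φs {ψ} →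
         Sat S ρ (foldr _⇒_ ψ φs) ⇔ (All (Sat S ρ) φs → Sat S ρ ψ)
Sat-⇒* []       = mk⇔ (λ s _ → s) (λ s → s [])
Sat-⇒* (φ ∷ φs) = mk⇔ (λ { s (p ∷ ps) → to⇔ (Sat-⇒* φs) (s p) ps }) (λ s p → from⇔ (Sat-⇒* φs) λ ps → s (p ∷ ps))

-- The variables come in blocks, one block for each quantifier, and a block of
-- k variables is interpreted by a function on Fin k.
data Var : List ℕ → Set where
  var : ∀ {k Γ} → Fin k → Var (k ∷ Γ)
  wk  : ∀ {k Γ} → Var Γ → Var (k ∷ Γ)

Env : Set → List ℕ → Set
Env X []      = ⊤
Env X (k ∷ Γ) = (Fin k → X) × Env X Γ

eval : ∀ {X Γ} → Env X Γ → Var Γ → X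
eval (f , _) (var i) = f i
eval (_ , e) (wk v)  = eval e v

position : ∀ {Γ} → Var Γ → Fin (sum Γ)
position {k ∷ Γ} (var i) = i ↑ˡ sum Γ
position {k ∷ Γ} (wk v)  = k ↑ʳ position v

flatten : ∀ {X Γ} → Env X Γ → Vec X (sum Γ)
flatten {Γ = []}    _       = []
flatten {Γ = _ ∷ _} (f , e) = tabulate f ⧺ flatten e

lookup-flatten : ∀ {X Γ} (e : Env X Γ) v → lookup (flatten e) (position v) ≡ eval e v
lookup-flatten (f , e) (var i) = trans (lookup-++ˡ (tabulate f) (flatten e) i) (lookup∘tabulate f i)
lookup-flatten (f , e) (wk v)  = trans (lookup-++ʳ (tabulate f) (flatten e) (position v)) (lookup-flatten e v)

-- Gadget formulas and their translation to first-order logic.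

module GadgetSentence (a′ b′ : ℕ) (a≤b : suc a′ ℕ.≤ suc b′) where

  open Gadget a′ b′ a≤b

  -- Bases are functions, and those obtained by evaluation or from the extension agree with the
  -- expected ones only pointwise.
  Gad-cong : ∀ {X} (S : Str X) {P P′ E} → P ≗ P′ → Gad S P E → Gad S P′ E
  Gad-cong S {P} {P′} {E} P≗P′ (inj , es) =
    (λ {x} {y} eq → inj (trans (w≗ x) (trans eq (sym (w≗ y))))) ,
    (λ j → IsEdge-resp S (w≗ (lo j)) (w≗ (inj₁ (hi j))) (w≗ (inj₂ (suc j))) (es j))
    where
    w≗ : [ E , P ]′ ≗ [ E , P′ ]′
    w≗ (inj₁ i) = refl
    w≗ (inj₂ p) = P≗P′ p

  Gad-embed : ∀ {X Y} {S : Str X} {S′ : Str Y} (f : S ↪ S′) {P E} → Gad S P E → Gad S′ (to f ∘ P) (to f ∘ E)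
  Gad-embed {S = S} {S′} f {P} {E} (inj , es) =
    (λ {x} {y} eq → inj (injective f (trans (w≗ x) (trans eq (sym (w≗ y)))))) ,
    (λ j → IsEdge-resp S′ (w≗ (lo j)) (w≗ (inj₁ (hi j))) (w≗ (inj₂ (suc j))) (subst T (sym (R-iff f _ _ _)) (es j)))
    where
    w≗ : ∀ x → to f ([ E , P ]′ x) ≡ [ to f ∘ E , to f ∘ P ]′ x
    w≗ (inj₁ i) = refl
    w≗ (inj₂ p) = refl

  infixr 5 _⇛_ _,_⊩_

  -- P , E ⊩ φ reads "if E is a gadget over P, then φ".
  data Fm (Γ : List ℕ) : Set where
    _≗ᵛ_  : Var Γ → Var Γ → Fm Γ
    _,_⊩_ : (Fin (suc b) → Var Γ) → (Fin a → Var Γ) → Fm Γ → Fm Γ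
    ⊥ᶠ    : Fm Γ
    _⇛_   : Fm Γ → Fm Γ → Fm Γ
    ∀ᶠ    : ∀ k → Fm (k ∷ Γ) → Fm Γ

  ⟦_⟧ : ∀ {Γ} → Fm Γ → ∀ {X} → Str X → Env X Γ → Set
  ⟦ u ≗ᵛ v ⟧    S e = eval e u ≡ eval e v
  ⟦ P , E ⊩ φ ⟧ S e = Gad S (λ p → eval e (P p)) (λ i → eval e (E i)) → ⟦ φ ⟧ S e
  ⟦ ⊥ᶠ ⟧        S e = ⊥
  ⟦ φ ⇛ ψ ⟧     S e = ⟦ φ ⟧ S e → ⟦ ψ ⟧ S e
  ⟦ ∀ᶠ k φ ⟧    S e = ∀ f → ⟦ φ ⟧ S (f , e)

  slots : List Slot
  slots = map inj₁ (allFin a) ++ map inj₂ (allFin (suc b))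

  ∈-slots : ∀ σ → σ ∈ slots
  ∈-slots (inj₁ i) = ∈-++⁺ˡ (∈-map⁺ inj₁ (∈-allFin i))
  ∈-slots (inj₂ p) = ∈-++⁺ʳ (map inj₁ (allFin a)) (∈-map⁺ inj₂ (∈-allFin p))

  distinct? : Decidable {A = Slot × Slot} (λ (σ , τ) → σ ≢ τ)
  distinct? (σ , τ) = ¬? (≡-dec Fin._≟_ Fin._≟_ σ τ)

  slotPairs : List (Slot × Slot)
  slotPairs = filter distinct? (cartesianProduct slots slots)

  distinctFormulas edgeFormulas gadgetFormulas : ∀ {n} → (Slot → Fin n) → List (Formula n)
  distinctFormulas w = map (λ (σ , τ) → (w σ ≐ w τ) ⇒ ⊥′) slotPairs
  edgeFormulas w     = map (λ j → rel (w (lo j)) (w (inj₁ (hi j))) (w (inj₂ (suc j)))) (allFin b)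
  gadgetFormulas w   = distinctFormulas w ++ edgeFormulas w

  compile : ∀ {Γ} → Fm Γ → Formula (sum Γ)
  compile (u ≗ᵛ v)    = position u ≐ position v
  compile (P , E ⊩ φ) = foldr _⇒_ (compile φ) (gadgetFormulas (position ∘ [ E , P ]′))
  compile ⊥ᶠ          = ⊥′
  compile (φ ⇛ ψ)     = compile φ ⇒ compile ψ
  compile (∀ᶠ k φ)    = ∀ⁿ k (compile φ)

  module _ {X : Set} (S : Str X) where

    gadgetFormulas-correct : ∀ {Γ} (e : Env X Γ) P E →
      All (Sat S (flatten e)) (gadgetFormulas (position ∘ [ E , P ]′)) ⇔
      Gad S (λ p → eval e (P p)) (λ i → eval e (E i))
    gadgetFormulas-correct e P E = mk⇔ fwd bwd
      where
      w : Slot → X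
      w = [ (λ i → eval e (E i)) , (λ p → eval e (P p)) ]′
      w≡ : ∀ σ → lookup (flatten e) (position ([ E , P ]′ σ)) ≡ w σ
      w≡ (inj₁ i) = lookup-flatten e (E i)
      w≡ (inj₂ p) = lookup-flatten e (P p)

      fwd : All (Sat S (flatten e)) (gadgetFormulas (position ∘ [ E , P ]′)) → Gad S _ _
      fwd all with All.++⁻ (distinctFormulas (position ∘ [ E , P ]′)) all
      ... | ds , es = inj , λ j → IsEdge-resp S (w≡ (lo j)) (w≡ (inj₁ (hi j))) (w≡ (inj₂ (suc j)))
                                    (All.lookup (All.map⁻ es) (∈-allFin j))
        where
        inj : Injective _≡_ _≡_ w
        inj {σ} {τ} eq with ≡-dec Fin._≟_ Fin._≟_ σ τ
        ... | yes σ≡τ = σ≡τ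
        ... | no  σ≢τ = ⊥-elim (All.lookup (All.map⁻ ds)
          (∈-filter⁺ distinct? (∈-cartesianProduct⁺ (∈-slots σ) (∈-slots τ)) σ≢τ) (trans (w≡ σ) (trans eq (sym (w≡ τ)))))

      bwd : Gad S _ _ → All (Sat S (flatten e)) (gadgetFormulas (position ∘ [ E , P ]′))
      bwd (inj , es) = All.++⁺ {xs = distinctFormulas (position ∘ [ E , P ]′)}
        (All.map⁺ (All.tabulate λ {(σ , τ)} στ∈ eq →
          proj₂ (∈-filter⁻ distinct? {xs = cartesianProduct slots slots} στ∈)
            (inj (trans (sym (w≡ σ)) (trans eq (w≡ τ))))))
        (All.map⁺ (All.tabulate λ {j} _ →
          IsEdge-resp S (sym (w≡ (lo j))) (sym (w≡ (inj₁ (hi j)))) (sym (w≡ (inj₂ (suc j)))) (es j)))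

    compile-correct : ∀ {Γ} (φ : Fm Γ) (e : Env X Γ) → Sat S (flatten e) (compile φ) ⇔ ⟦ φ ⟧ S e
    compile-correct (u ≗ᵛ v) e = mk⇔
      (λ eq → trans (sym (lookup-flatten e u)) (trans eq (lookup-flatten e v)))
      (λ eq → trans (lookup-flatten e u) (trans eq (sym (lookup-flatten e v))))
    compile-correct (P , E ⊩ φ) e = mk⇔
      (λ s g → to⇔ (compile-correct φ e) (to⇔ (Sat-⇒* fs) s (from⇔ (gadgetFormulas-correct e P E) g)))
      (λ s → from⇔ (Sat-⇒* fs) λ all → from⇔ (compile-correct φ e) (s (to⇔ (gadgetFormulas-correct e P E) all)))
      where fs = gadgetFormulas (position ∘ [ E , P ]′)
    compile-correct ⊥ᶠ e = mk⇔ (λ x → x) (λ x → x)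
    compile-correct (φ ⇛ ψ) e = mk⇔
      (λ s p → to⇔ (compile-correct ψ e) (s (from⇔ (compile-correct φ e) p)))
      (λ s p → from⇔ (compile-correct ψ e) (s (to⇔ (compile-correct φ e) p)))
    compile-correct (∀ᶠ k φ) e = mk⇔
      (λ s f → to⇔ (compile-correct φ (f , e)) (to⇔ (Sat-∀ⁿ k) s (tabulate f)))
      -- Every vector is the table of its lookup function, so quantifying over functions and over
      -- vectors amounts to the same.
      (λ s → from⇔ (Sat-∀ⁿ k) λ v → subst (λ v → Sat S (v ⧺ flatten e) (compile φ)) (tabulate∘lookup v)
        (from⇔ (compile-correct φ (lookup v , e)) (s (lookup v))))

  -- The first two places of a base lie on the first edge of its gadgets, so a gadget over this base
  -- puts `y` and `x` on a common edge.
  link : ∀ {A : Set} → (Fin (suc b) → A) → A → A → Fin (suc b) → A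
  link P y x zero          = y
  link P y x (suc zero)    = x
  link P y x (suc (suc p)) = P (suc (suc p))

  link-eval : ∀ {X Γ} (e : Env X Γ) P y x → (λ p → eval e (link P y x p)) ≗ link (eval e ∘ P) (eval e y) (eval e x)
  link-eval e P y x zero          = refl
  link-eval e P y x (suc zero)    = refl
  link-eval e P y x (suc (suc p)) = refl

  -- `growing` says that for every P there are P′ and E₀ such that Z P injects into
  -- Z P′ without the point E₀ 0.  The injection is coded by the gadgets over
  -- link P′ y x, one for each x in Z P with image y.
  private
    Γ₃ : List ℕ
    Γ₃ = a ∷ suc b ∷ suc b ∷ []

    P₃ P₃′ : Fin (suc b) → Var Γ₃
    P₃  p = wk (wk (var p))
    P₃′ p = wk (var p)

  covered functional : Fm Γ₃
  covered =
    ∀ᶠ a ((λ p → wk (P₃ p)) , var ⊩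
      ∀ᶠ a (∀ᶠ a ((wk (var zero) ≗ᵛ wk (wk (wk (var zero))) ⇛ ⊥ᶠ) ⇛
        (λ p → wk (wk (wk (P₃′ p)))) , (λ i → wk (var i)) ⊩
        link (λ p → wk (wk (wk (P₃′ p)))) (wk (var zero)) (wk (wk (var zero))) , var ⊩
        ⊥ᶠ)) ⇛ ⊥ᶠ)
  functional =
    ∀ᶠ a ((λ p → wk (P₃ p)) , var ⊩
    ∀ᶠ a ((λ p → wk (wk (P₃ p))) , var ⊩
    ∀ᶠ a ((λ p → wk (wk (wk (P₃′ p)))) , var ⊩
    ∀ᶠ a (link (λ p → wk (wk (wk (wk (P₃′ p))))) (wk (var zero)) (wk (wk (wk (var zero)))) , var ⊩
    ∀ᶠ a (link (λ p → wk (wk (wk (wk (wk (P₃′ p)))))) (wk (wk (var zero))) (wk (wk (wk (var zero)))) , var ⊩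
    wk (wk (wk (wk (var zero)))) ≗ᵛ wk (wk (wk (var zero))))))))

  -- The empty structure satisfies `growing` vacuously and has to be excluded. The conjunction is
  -- written as a negated implication.
  nonempty growing sentence : Fm []
  nonempty = ∀ᶠ (suc b) ⊥ᶠ ⇛ ⊥ᶠ
  growing  = ∀ᶠ (suc b) (∀ᶠ (suc b) (∀ᶠ a ((λ p → wk (var p)) , var ⊩ covered ⇛ functional ⇛ ⊥ᶠ)) ⇛ ⊥ᶠ)
  sentence = (nonempty ⇛ growing ⇛ ⊥ᶠ) ⇛ ⊥ᶠ

  -- The coded relation may give one `x` several images. Counting only takes that each `x` has an
  -- image, up to double negation, and that an image determines its `x`.
  record Grows {X} (S : Str X) (P P′ : Fin (suc b) → X) (E₀ : Fin a → X) : Set where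
    field
      fresh  : Gad S P′ E₀
      covers : ∀ {E} → Gad S P E →
               ¬ (∀ E′ E″ → E′ zero ≢ E₀ zero → Gad S P′ E′ → ¬ Gad S (link P′ (E′ zero) (E zero)) E″)
      maps   : ∀ {E Ẽ E′ E″ E‴} → Gad S P E → Gad S P Ẽ → Gad S P′ E′ →
               Gad S (link P′ (E′ zero) (E zero)) E″ → Gad S (link P′ (E′ zero) (Ẽ zero)) E‴ →
               E zero ≡ Ẽ zero
  open Grows

  sentence⁺ : ∀ {X} {S : Str X} → (Fin (suc b) → X) → (∀ P → ∃[ P′ ] ∃[ E₀ ] Grows S P P′ E₀) → S ⊨ compile sentence
  sentence⁺ {X} {S} P₀ grows = from⇔ (compile-correct S sentence tt) λ s → s (λ ¬P → ¬P P₀) λ P ¬grows →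
    let P′ , E₀ , G = grows P in ¬grows P′ E₀ (fresh G)
      (λ E g ¬E → covers G g λ E′ E″ ≢E₀ g′ g″ →
        ¬E E′ E″ ≢E₀ g′ (Gad-cong S (sym ∘ link-eval (E″ , E′ , E , E₀ , P′ , P , tt) _ _ _) g″))
      (λ E g Ẽ g̃ E′ g′ E″ g″ E‴ g‴ → maps G g g̃ g′
        (Gad-cong S (link-eval (E″ , E′ , Ẽ , E , E₀ , P′ , P , tt) _ _ _) g″)
        (Gad-cong S (link-eval (E‴ , E″ , E′ , Ẽ , E , E₀ , P′ , P , tt) _ _ _) g‴))

  sentence⁻ : ∀ {X} {S : Str X} → S ⊨ compile sentence →
              ¬ ¬ ((Fin (suc b) → X) × (∀ P → ¬ (∀ P′ E₀ → ¬ Grows S P P′ E₀)))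
  sentence⁻ {X} {S} s k = to⇔ (compile-correct S sentence tt) s λ ne gr → ne λ P₀ → k (P₀ , λ P ¬grows →
    gr P λ P′ E₀ g₀ cov fun → ¬grows P′ E₀ record
      { fresh  = g₀
      ; covers = λ {E} g ¬E → cov E g λ E′ E″ ≢E₀ g′ g″ →
          ¬E E′ E″ ≢E₀ g′ (Gad-cong S (link-eval (E″ , E′ , E , E₀ , P′ , P , tt) _ _ _) g″)
      ; maps   = λ {E} {Ẽ} {E′} {E″} {E‴} g g̃ g′ g″ g‴ → fun E g Ẽ g̃ E′ g′
          E″ (Gad-cong S (sym ∘ link-eval (E″ , E′ , Ẽ , E , E₀ , P′ , P , tt) _ _ _) g″)
          E‴ (Gad-cong S (sym ∘ link-eval (E‴ , E″ , E′ , Ẽ , E , E₀ , P′ , P , tt) _ _ _) g‴)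
      })

  -- Models of the sentence are infinite.

  module _ {X : Set} (S : Str X) where

    HasMany : ℕ → Set
    HasMany c = ∃[ P ] ∃[ xs ] Unique xs × length xs ≡ c × All (λ x → ∃[ E ] Gad S P E × E zero ≡ x) xs

    module _ {P P′ E₀} (G : Grows S P P′ E₀) where

      _↦_ : X → X → Set
      x ↦ y = (∃[ E ] Gad S P E × E zero ≡ x) × (∃[ E′ ] Gad S P′ E′ × E′ zero ≡ y) × y ≢ E₀ zero ×
              ∃[ E″ ] Gad S (link P′ y x) E″

      ↦-injective : ∀ {x x′ y} → x ↦ y → x′ ↦ y → x ≡ x′
      ↦-injective ((_ , g , refl) , (_ , g′ , refl) , _ , _ , g″) ((_ , g̃ , refl) , _ , _ , _ , g‴) =
        maps G g g̃ g′ g″ g‴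

      image-gadget : ∀ {y xs} → Any (_↦ y) xs → (∃[ E ] Gad S P′ E × E zero ≡ y) × y ≢ E₀ zero
      image-gadget ∃x with Any.satisfied ∃x
      ... | _ , _ , gadget , y≢E₀ , _ = gadget , y≢E₀

      Images : List X → List X → Set
      Images xs ys = Unique ys × length ys ≡ length xs × All (λ y → Any (_↦ y) xs) ys

      separate : ∀ {x xs y y′} → All (x ≢_) xs → x ↦ y → y ≡ y′ → ¬ Any (_↦ y′) xs
      separate (x≢x′ ∷ _) x↦y refl (here x′↦y) = x≢x′ (↦-injective x↦y x′↦y)
      separate (_ ∷ x∉xs) x↦y refl (there ∃x′) = separate x∉xs x↦y refl ∃x′

      images : ∀ {xs} → Unique xs → All (λ x → ∃[ E ] Gad S P E × E zero ≡ x) xs → ¬ (∀ ys → ¬ Images xs ys)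
      images []          []                    k = k [] ([] , refl , [])
      images (x∉xs ∷ u) ((E , g , refl) ∷ gs) k = images u gs λ ys (ys! , eq , ys↦) →
        covers G g λ E′ E″ ≢E₀ g′ g″ → k (E′ zero ∷ ys)
          ( All.map (λ ∃x′ E′≡y → separate x∉xs ((E , g , refl) , (E′ , g′ , refl) , ≢E₀ , E″ , g″) E′≡y ∃x′)
              ys↦ ∷ ys!
          , cong suc eq
          , here ((E , g , refl) , (E′ , g′ , refl) , ≢E₀ , E″ , g″) ∷ All.map there ys↦ )

      -- The chosen images are distinct first points of gadgets over `P′` and avoid `E₀ zero`, which
      -- is therefore one more such point.
      more : ∀ {xs} → Unique xs → All (λ x → ∃[ E ] Gad S P E × E zero ≡ x) xs → ¬ ¬ HasMany (suc (length xs))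
      more u gs k = images u gs λ ys (ys! , eq , ys↦) → k (P′ , E₀ zero ∷ ys ,
        All.map (λ ∃x E₀≡y → proj₂ (image-gadget ∃x) (sym E₀≡y)) ys↦ ∷ ys! , cong suc eq ,
        (E₀ , fresh G , refl) ∷ All.map (proj₁ ∘ image-gadget) ys↦)

    -- Induction on `c` replaces the choice of a maximal Z P, which would require deciding sizes.
    -- The existentials of the sentence hold only up to double negation; this is harmless, since the
    -- goal in a finite model is a contradiction.
    has-many : S ⊨ compile sentence → ∀ c → ¬ ¬ HasMany c
    has-many s zero    k = sentence⁻ s λ (P₀ , _) → k (P₀ , [] , [] , refl , [])
    has-many s (suc c) k = sentence⁻ s λ (_ , grows) → has-many s c λ (P , xs , u , eq , gs) →
      grows P λ P′ E₀ G → more G u gs λ many → k (subst (λ c → HasMany (suc c)) eq many)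

  no-finite-model : ∀ {n} (N : Str (Fin n)) → ¬ N ⊨ compile sentence
  no-finite-model {n} N s = has-many N s (suc n) λ (_ , xs , u , eq , _) →
    ℕ.<⇒≱ (ℕ.n<1+n n) (subst₂ ℕ._≤_ eq (length-allFin n)
      (length-≤ {ys = allFin n} (λ x → x) (λ eq → eq) u (λ _ → ∈-allFin _)))

-- The sentence holds in the generic structure

module OldEdges (a′ b′ : ℕ) (a≤b : suc a′ ℕ.≤ suc b′) {m k : ℕ} (S₀ : Str (Fin m)) (s : Fin k → Fin m) where

  open Gadget a′ b′ a≤b
  open Extend a′ b′ a≤b S₀ s

  Owner : V → Fin k → Set
  Owner v i = ∃[ g ] ∃[ y ] v ≡ pt g i y

  Owner-functional : ∀ {v i i′} → Owner v i → Owner v i′ → i ≡ i′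
  Owner-functional (_ , _ , refl) (_ , _ , refl) = refl

  w-pre≢old : ∀ g i y {x} → old x ≢ w g i (pre y)
  w-pre≢old false i zero    ()
  w-pre≢old true  i zero    ()
  w-pre≢old g     i (suc y) ()

  -- A new edge contains an old point only if it is the first edge of a link gadget. That point is
  -- `s i`, and both other vertices carry the same index `i`.
  old-edge : ∀ {v u x} → Edge (v , u , old x) → ¬ (∃[ y ] v ≡ old y) → ∃[ i ] x ≡ s i × Owner v i
  old-edge (inj₁ (oldEdge _)) ¬old = ⊥-elim (¬old (_ , refl))
  old-edge {v} {u} {x} (inj₂ (_ , t∈)) ¬old with find t∈
  ... | (g , i , j) , _ , ((v∈ ∷ _ ∷ x∈ ∷ []) , _) = go g j x∈ v∈
    where
    owner : v ∈ toList (end (true , i , zero)) → ∃[ y ] s i ≡ y × Owner v i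
    owner (0th eq) = s i , refl , false , zero , trans eq (cong (w true i) lo-zero)
    owner (1st eq) = s i , refl , true , hi zero , eq
    owner (2nd eq) = ⊥-elim (¬old (s i , eq))

    go : ∀ g j → old x ∈ toList (end (g , i , j)) → v ∈ toList (end (g , i , j)) → ∃[ i ] x ≡ s i × Owner v i
    go g     j       (0th eq)   _ = ⊥-elim (w-pre≢old g i (hi j) eq)
    go true  zero    (2nd refl) v∈ = i , refl , proj₂ (proj₂ (owner v∈))

module Generic (α : ℚ) (a′ b′ : ℕ) (α≃a/b : ℚ.toℚᵘ α ≃ᵘ mkℚᵘ (ℤ.+ suc a′) b′) (a≤b : suc a′ ℕ.≤ suc b′)
               {X : Set} (_≟_ : DecidableEquality X) (M : Str X) (generic : IsGeneric α M) where

  open Gadget a′ b′ a≤b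
  open GadgetSentence a′ b′ a≤b
  open Closed α α≃a/b _≟_ M using (gad-closed)

  first-edge : ∀ {P E} → Gad M P E → T (R M (P zero) (E zero) (P (suc zero)))
  first-edge {P} {E} (_ , es) = subst₂ (λ σ i → T (R M ([ E , P ]′ σ) (E i) (P (suc zero)))) lo-zero hi-zero (es zero)

  module _ (P : Fin (suc b) → X) (A : FinSubset X) (A-strong : StrongIn α M A) (P∈A : ∀ p → P p ∈ elems A) where

    private
      -- Index suc i serves the i-th point of A; the gadget E₀ at index 0 is the
      -- surplus one, and its link is arbitrary.
      s : Fin (suc ∣ A ∣) → Fin ∣ A ∣
      s zero    = index (P∈A zero)
      s (suc i) = i

    open Realise α a′ b′ α≃a/b a≤b _≟_ M generic A A-strong s
    open OldEdges a′ b′ a≤b (M ↾ A) s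

    private
      P′ : Fin (suc b) → X
      P′ = to h ∘ par

      E₀ : Fin a → X
      E₀ = to h ∘ pt false zero

      H        = proj₁ strong-range
      H-strong = proj₁ (proj₂ strong-range)
      h∈H      = proj₁ (proj₂ (proj₂ strong-range))
      H⁻       = proj₂ (proj₂ (proj₂ strong-range))

      gadgetₕ : ∀ g i → Gad M (to h ∘ base g i) (to h ∘ pt g i)
      gadgetₕ g i = Gad-embed h (gadget g i)

      edgeₕ : ∀ {x y z} u v w → x ≡ to h u → y ≡ to h v → z ≡ to h w → T (R M x y z) → Edge (u , v , w)
      edgeₕ u v w refl refl refl e = T-does (edge? (u , v , w)) (subst T (R-iff h u v w) e)

      in-A : ∀ {E} → Gad M P E → ∃[ x ] E zero ≡ to h (old x)
      in-A {E} g = index p , trans (Any.lookup-index p) (sym (h-old (index p)))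
        where p = gad-closed A P∈A g A-strong zero

      link-∈H : ∀ {y x} → y ∈ elems H → x ∈ elems H → ∀ p → link P′ y x p ∈ elems H
      link-∈H y∈ x∈ zero          = y∈
      link-∈H y∈ x∈ (suc zero)    = x∈
      link-∈H y∈ x∈ (suc (suc p)) = h∈H (par (suc (suc p)))

      base-link : ∀ i {y} → y ≡ to h (old i) →
                  to h ∘ base true (suc i) ≗ link P′ (to h (pt false (suc i) zero)) y
      base-link i eq zero          = refl
      base-link i eq (suc zero)    = sym eq
      base-link i eq (suc (suc p)) = refl

      -- If `E′ zero` were old, the first edge of the gadget would join it to `par zero`, which by
      -- `old-edge` would have to be a gadget point. Being new is what allows `old-edge` to be
      -- applied to links at this point.
      new-point : ∀ {E′} → Gad M P′ E′ → ∃[ v ] E′ zero ≡ to h v × ¬ (∃[ y ] v ≡ old y)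
      new-point {E′} g′ = v , E′≡ , λ (y , v≡) →
        par-unowned (old-edge {par zero} {par (suc zero)} {y} (Edge-swap₂₃ (subst (λ v → Edge (par zero , v , par (suc zero))) v≡
          (edgeₕ (par zero) v (par (suc zero)) refl E′≡ refl (first-edge g′)))) λ ())
        where
        v   = proj₁ (H⁻ (gad-closed H (h∈H ∘ par) g′ H-strong zero))
        E′≡ = proj₂ (H⁻ (gad-closed H (h∈H ∘ par) g′ H-strong zero))
        par-unowned : ∀ {x p} → ¬ (∃[ i ] x ≡ s i × Owner (par p) i)
        par-unowned (_ , _ , _ , _ , ())

      linked : ∀ {y z v x E″} → y ≡ to h v → ¬ (∃[ y ] v ≡ old y) → z ≡ to h (old x) →
               Gad M (link P′ y z) E″ → ∃[ i ] x ≡ s i × Owner v i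
      linked {v = v} {x} {E″} refl ¬old refl g″ =
        old-edge {v} {u} {x} (edgeₕ v u (old x) refl E″≡ refl (first-edge g″)) ¬old
        where
        u   = proj₁ (H⁻ (gad-closed H (link-∈H (h∈H v) (h∈H (old x))) g″ H-strong zero))
        E″≡ = proj₂ (H⁻ (gad-closed H (link-∈H (h∈H v) (h∈H (old x))) g″ H-strong zero))

    grows-over : Grows M P P′ E₀
    grows-over .Grows.fresh = gadgetₕ false zero
    grows-over .Grows.covers g ¬E =
      let i , E≡ = in-A g in
      ¬E (to h ∘ pt false (suc i)) (to h ∘ pt true (suc i))
        (λ eq → distinct-pt (injective h eq))
        (gadgetₕ false (suc i))
        (Gad-cong M (base-link i E≡) (gadgetₕ true (suc i)))
      where
      distinct-pt : ∀ {i} → pt false (suc i) zero ≢ pt false zero zero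
      distinct-pt ()
    -- Both links pass through the same new vertex `v`, whose index fixes the old point. This works
    -- for whatever gadgets of `M` the witnesses are, intended or not.
    grows-over .Grows.maps g g̃ g′ g″ g‴ =
      let x , E≡         = in-A g
          x̃ , Ẽ≡         = in-A g̃
          v , E′≡ , ¬old = new-point g′
          i , x≡ , o     = linked E′≡ ¬old E≡ g″
          ĩ , x̃≡ , õ     = linked E′≡ ¬old Ẽ≡ g‴
      in trans E≡ (trans (cong (to h ∘ old) (trans x≡ (trans (cong s (Owner-functional o õ)) (sym x̃≡)))) (sym Ẽ≡))

    grows : ∃[ P′ ] ∃[ E₀ ] Grows M P P′ E₀
    grows = P′ , E₀ , grows-over

  module _ (A : ℕ → FinSubset X) (A≤A : ∀ i → Strong α M (A i) (A (suc i))) (covering : ∀ x → ∃[ i ] x ∈ elems (A i)) where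

    open Weighted.Chain α (suc a′) b′ α≃a/b _≟_ M A A≤A

    grows-anywhere : ∀ P → ∃[ P′ ] ∃[ E₀ ] Grows M P P′ E₀
    grows-anywhere P = grows P (A i) (strongIn covering i) λ p → All.lookup P⊆A (∈-map⁺ P (∈-allFin p))
      where
      i   = proj₁ (covers-list covering (map P (allFin (suc b))))
      P⊆A = proj₂ (covers-list covering (map P (allFin (suc b))))

  -- The empty set is strong in `M`, and a bare base without gadgets extends it strongly.
  point : Fin (suc b) → X
  point = to h ∘ par
    where open Realise α a′ b′ α≃a/b a≤b _≟_ M generic ∅ (λ B _ → IsGeneric.inClass generic B) {0} (λ ())

  no-fmp : ¬ FiniteModelProperty M
  no-fmp fmp =
    let A , _ , A≤A , covering = IsGeneric.chain generic
        _ , N , N⊨ = fmp (compile sentence) (sentence⁺ point (grows-anywhere A A≤A covering))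
    in no-finite-model N N⊨

theorem3p4 : (α : ℚ) → 0ℚ < α → α ≤ 1ℚ → (X : Set) → X ↣ ℕ → (M : Str X) → IsGeneric α M → ¬ FiniteModelProperty M
theorem3p4 α@(mkℚ ℤ.+[1+ a′ ] b′ _) _ (ℚ.*≤* α≤1) X X↣ℕ M generic =
  Generic.no-fmp α a′ b′ ℚᵘ.≃-refl
    -- The bound α ≤ 1 becomes `a ≤ b`, by which an edge owns cells of at most two gadget points.
    (ℤ.drop‿+≤+ (subst₂ ℤ._≤_ (ℤ.*-identityʳ (ℤ.+ suc a′)) (ℤ.*-identityˡ (ℤ.+ suc b′)) α≤1))
    -- Countability enters through the decidable equality on `X` that it provides.
    (ℕ.eq? X↣ℕ) M generic
theorem3p4 (mkℚ (ℤ.+ 0)     _ _) (ℚ.*<* (ℤ.+<+ ()))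
theorem3p4 (mkℚ ℤ.-[1+ _ ] _ _) (ℚ.*<* ())
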